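{- For every integer $k\ge 2$ and every positive integer $n$, \[ \mathrm{ex}^{\mathrm{lin}}_3\big(n, C^{(3)}_{2k+1}\big)\le 2k\,n^{1+1/k}+9kn. \]
   Context: A 3-uniform hypergraph is linear if any two distinct hyperedges share at most one vertex. A Berge cycle of length $m$ is a family of $m$ distinct hyperedges $H_0,\dots,H_{m-1}$ for which there exist distinct vertices $v_0,\dots,v_{m-1}$ with $\{v_i,v_{i+1}\}\subset H_i$ for $0\le i\le m-1$ (indices mod $m$). $\mathrm{ex}^{\mathrm{lin}}_3(n,C^{(3)}_m)$ is the maximum number of hyperedges in a 3-uniform linear hypergraph on $n$ vertices containing no Berge cycle of length $m$. -}

module Defs where

open import Algebra.Definitions.RawSemiring using () renaming (_^_ to pow)
open import Data.Bool.Base using (true; false)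
open import Data.Fin.Base using (Fin; zero; suc; toℕ; combine)
open import Data.Fin.Properties as Finₚ
  using (any?; all?; combine-injective; injective⇒≤)
open import Data.Fin.Subset using (Subset; _∈_; _∩_; ∣_∣)
open import Data.Fin.Subset.Properties using (_∈?_; anySubset?)
open import Data.Integer.Base using (+_)
open import Data.Nat.Base as ℕ using (ℕ; zero; suc; NonZero)
open import Data.Nat.DivMod using (_mod_)
open import Data.Nat.Properties as ℕₚ using ()
open import Data.Product.Base using (∃; _×_; _,_; proj₁; proj₂)
open import Data.Rational.Base as ℚ using (ℚ; 0ℚ)
open import Data.Vec.Base using ([]; _∷_)
open import Function.Base using (_∘_; _$_)
open import Function.Definitions using (Injective)
open import Level using (0ℓ)
open import Relation.Binary.PropositionalEquality
  using (_≡_; _≢_; _≗_; refl; sym; trans; cong; subst; subst₂)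
open import Relation.Nullary using (¬_; Dec; yes; no)
open import Relation.Nullary.Decidable
  using (map′; _×-dec_; _→-dec_; ¬?)
open import Relation.Unary using (Pred; Decidable)

------------------------------------------------------------------------
-- Linear 3-uniform hypergraphs and Berge cycles

-- The vertex set is Fin n.  A hypergraph with e hyperedges is given by an
-- injective enumeration of its hyperedges by Fin e.

record Is3Hypergraph {n e : ℕ} (edge : Fin e → Subset n) : Set where
  constructor is3Hypergraph
  field
    distinct : Injective _≡_ _≡_ edge
    uniform  : ∀ i → ∣ edge i ∣ ≡ 3

Linear : {n e : ℕ} → (Fin e → Subset n) → Set
Linear edge = ∀ i j → i ≢ j → ∣ edge i ∩ edge j ∣ ℕ.≤ 1

next : {m : ℕ} .{{_ : NonZero m}} → Fin m → Fin m
next {m} i = suc (toℕ i) mod m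

record IsBergeCycle {n e m : ℕ} .{{_ : NonZero m}} (edge : Fin e → Subset n)
                    (H : Fin m → Fin e) (v : Fin m → Fin n) : Set where
  constructor isBergeCycle
  field
    H-distinct : Injective _≡_ _≡_ H
    v-distinct : Injective _≡_ _≡_ v
    incident   : ∀ i → v i ∈ edge (H i) × v (next i) ∈ edge (H i)

HasBergeCycle : {n e : ℕ} (m : ℕ) .{{_ : NonZero m}} →
                (Fin e → Subset n) → Set
HasBergeCycle m edge = ∃ λ (H : Fin m → Fin _) → ∃ λ v → IsBergeCycle edge H v

-- Some linear 3-uniform hypergraph on n vertices without Berge cycles of
-- length m has exactly e hyperedges.

Attains : (n m : ℕ) .{{_ : NonZero m}} → ℕ → Set
Attains n m e = ∃ λ (edge : Fin e → Subset n) →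
  Is3Hypergraph edge × Linear edge × ¬ HasBergeCycle m edge

IsMaximum : (ℕ → Set) → ℕ → Set
IsMaximum P e = P e × (∀ e′ → P e′ → e′ ℕ.≤ e)

------------------------------------------------------------------------
-- The maximum exists: Attains is decidable, bounded, and holds at 0

private

  Searchable : Set → Set₁
  Searchable A = {P : Pred A 0ℓ} → Decidable P → Dec (∃ P)

  cons : {A : Set} {m : ℕ} → A → (Fin m → A) → Fin (suc m) → A
  cons a f zero    = a
  cons a f (suc i) = f i

  cons-cong : {A : Set} {m : ℕ} (a : A) {f g : Fin m → A} →
              f ≗ g → cons a f ≗ cons a g
  cons-cong a eq zero    = refl
  cons-cong a eq (suc i) = eq i

  cons-η : {A : Set} {m : ℕ} (f : Fin (suc m) → A) →
           f ≗ cons (f zero) (f ∘ suc)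
  cons-η f zero    = refl
  cons-η f (suc i) = refl

  Extensional : {A : Set} {m : ℕ} → Pred (Fin m → A) 0ℓ → Set
  Extensional P = ∀ {f g} → f ≗ g → P f → P g

  anyFun? : {A : Set} → Searchable A → ∀ m {P : Pred (Fin m → A) 0ℓ} →
            Extensional P → Decidable P → Dec (∃ P)
  anyFun? s zero ext P? =
    map′ (λ p → _ , p) (λ (_ , p) → ext (λ ()) p) (P? (λ ()))
  anyFun? s (suc m) ext P? =
    map′ (λ (a , f , p) → cons a f , p)
         (λ (f , p) → f zero , f ∘ suc , ext (cons-η f) p)
         (s λ a → anyFun? s m (ext ∘ cons-cong a) (P? ∘ cons a))

  injective-ext : {A : Set} {m : ℕ} {f g : Fin m → A} → f ≗ g →
                  Injective _≡_ _≡_ f → Injective _≡_ _≡_ g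
  injective-ext eq inj {x} {y} p =
    inj (trans (eq x) (trans p (sym (eq y))))

  injective? : {A : Set} → (∀ (x y : A) → Dec (x ≡ y)) →
               ∀ {m} (f : Fin m → A) → Dec (Injective _≡_ _≡_ f)
  injective? _≟_ f =
    map′ (λ h {x} {y} → h x y) (λ h x y → h {x} {y})
         (all? λ x → all? λ y → (f x ≟ f y) →-dec (x Finₚ.≟ y))

  _≟ˢ_ : {n : ℕ} (p q : Subset n) → Dec (p ≡ q)
  _≟ˢ_ = ≡-dec Bool._≟_
    where
    open import Data.Vec.Properties using (≡-dec)
    import Data.Bool.Properties as Bool

  module _ {n e m : ℕ} .{{_ : NonZero m}} where

    berge-ext : {edge edge′ : Fin e → Subset n} {H H′ : Fin m → Fin e}
                {v v′ : Fin m → Fin n} →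
                edge ≗ edge′ → H ≗ H′ → v ≗ v′ →
                IsBergeCycle edge H v → IsBergeCycle edge′ H′ v′
    berge-ext {edge} {edge′} {H} {H′} eqE eqH eqv (isBergeCycle dH dv inc) =
      isBergeCycle (injective-ext eqH dH) (injective-ext eqv dv) λ i →
        subst₂ _∈_ (eqv i) (eq i) (proj₁ (inc i)) ,
        subst₂ _∈_ (eqv (next i)) (eq i) (proj₂ (inc i))
      where
      eq : ∀ i → edge (H i) ≡ edge′ (H′ i)
      eq i = trans (cong edge (eqH i)) (eqE (H′ i))

    isBergeCycle? : (edge : Fin e → Subset n) (H : Fin m → Fin e)
                    (v : Fin m → Fin n) → Dec (IsBergeCycle edge H v)
    isBergeCycle? edge H v =
      map′ to from
           (injective? Finₚ._≟_ H ×-dec injective? Finₚ._≟_ v ×-dec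
            all? λ i → (v i ∈? edge (H i)) ×-dec (v (next i) ∈? edge (H i)))
      where
      Conditions : Set
      Conditions = Injective _≡_ _≡_ H × Injective _≡_ _≡_ v ×
                   (∀ i → v i ∈ edge (H i) × v (next i) ∈ edge (H i))

      to : Conditions → IsBergeCycle edge H v
      to (a , b , c) = isBergeCycle a b c

      from : IsBergeCycle edge H v → Conditions
      from (isBergeCycle a b c) = a , b , c

    hasBergeCycle? : (edge : Fin e → Subset n) → Dec (HasBergeCycle m edge)
    hasBergeCycle? edge =
      anyFun? any? m
        (λ eqH (v , c) → v , berge-ext (λ _ → refl) eqH (λ _ → refl) c)
        (λ H → anyFun? any? m
          (λ eqv → berge-ext (λ _ → refl) (λ _ → refl) eqv)
          (isBergeCycle? edge H))

  is3Hypergraph? : {n e : ℕ} (edge : Fin e → Subset n) →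
                   Dec (Is3Hypergraph edge)
  is3Hypergraph? edge =
    map′ to from (injective? _≟ˢ_ edge ×-dec all? λ i → ∣ edge i ∣ ℕₚ.≟ 3)
    where
    Conditions : Set
    Conditions = Injective _≡_ _≡_ edge × (∀ i → ∣ edge i ∣ ≡ 3)

    to : Conditions → Is3Hypergraph edge
    to (a , b) = is3Hypergraph a b

    from : Is3Hypergraph edge → Conditions
    from (is3Hypergraph a b) = a , b

  attains? : (n m : ℕ) .{{_ : NonZero m}} → Decidable (Attains n m)
  attains? n m e = anyFun? anySubset? e ext λ edge →
    is3Hypergraph? edge
    ×-dec (all? λ i → all? λ j →
             ¬? (i Finₚ.≟ j) →-dec (∣ edge i ∩ edge j ∣ ℕₚ.≤? 1))
    ×-dec ¬? (hasBergeCycle? edge)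
    where
    ext : Extensional λ (edge : Fin e → Subset n) →
            Is3Hypergraph edge × Linear edge × ¬ HasBergeCycle m edge
    ext eq (is3Hypergraph d u , l , ¬c) =
      is3Hypergraph (injective-ext eq d)
                    (λ i → subst (λ E → ∣ E ∣ ≡ 3) (eq i) (u i)) ,
      (λ i j i≢j → subst₂ (λ E F → ∣ E ∩ F ∣ ℕ.≤ 1) (eq i) (eq j) (l i j i≢j)) ,
      λ (H , v , c) →
        ¬c (H , v , berge-ext (sym ∘ eq) (λ _ → refl) (λ _ → refl) c)

  encode : {n : ℕ} → Subset n → Fin (2 ℕ.^ n)
  encode []          = zero
  encode (false ∷ p) = combine {2} zero (encode p)
  encode (true  ∷ p) = combine {2} (suc zero) (encode p)

  encode-injective : {n : ℕ} → Injective _≡_ _≡_ (encode {n})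
  encode-injective {x = []} {[]} _ = refl
  encode-injective {x = false ∷ p} {false ∷ q} eq =
    cong (false ∷_) $ encode-injective $
      proj₂ (combine-injective {2} zero (encode p) zero (encode q) eq)
  encode-injective {x = true ∷ p} {true ∷ q} eq =
    cong (true ∷_) $ encode-injective $
      proj₂ (combine-injective {2} (suc zero) (encode p) (suc zero) (encode q) eq)
  encode-injective {x = false ∷ p} {true ∷ q} eq
    with () ← proj₁ (combine-injective {2} zero (encode p) (suc zero) (encode q) eq)
  encode-injective {x = true ∷ p} {false ∷ q} eq
    with () ← proj₁ (combine-injective {2} (suc zero) (encode p) zero (encode q) eq)

  attains-bounded : (n m : ℕ) .{{_ : NonZero m}} →
                    ∀ e → Attains n m e → e ℕ.≤ 2 ℕ.^ n
  attains-bounded n m e (edge , h , _) =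
    injective⇒≤ {f = encode ∘ edge}
                (Is3Hypergraph.distinct h ∘ encode-injective)

  attains-zero : (n m : ℕ) .{{_ : NonZero m}} → Attains n m 0
  attains-zero n (suc m) =
    (λ ()) , is3Hypergraph (λ { {()} }) (λ ()) , (λ ()) ,
    λ (H , _) → Finₚ.¬Fin0 (H zero)

  maximum : {P : ℕ → Set} → Decidable P → P 0 → ∀ N →
            (∀ e → P e → e ℕ.≤ N) → ∃ (IsMaximum P)
  maximum P? p₀ zero    bound = 0 , p₀ , bound
  maximum P? p₀ (suc N) bound with P? (suc N)
  ... | yes p = suc N , p , bound
  ... | no ¬p = maximum P? p₀ N λ e p →
    ℕₚ.≤-pred (ℕₚ.≤∧≢⇒< (bound e p) λ { refl → ¬p p })

abstract

  maximumExists : (n m : ℕ) .{{_ : NonZero m}} → ∃ (IsMaximum (Attains n m))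
  maximumExists n m =
    maximum (attains? n m) (attains-zero n m) (2 ℕ.^ n) (attains-bounded n m)

ex : (n m : ℕ) .{{_ : NonZero m}} → ℕ
ex n m = proj₁ (maximumExists n m)

ex-isMaximum : (n m : ℕ) .{{_ : NonZero m}} → IsMaximum (Attains n m) (ex n m)
ex-isMaximum n m = proj₂ (maximumExists n m)

------------------------------------------------------------------------
-- Rational upper bounds of n^(1+1/k)

fromℕ : ℕ → ℚ
fromℕ n = + n ℚ./ 1

infixr 8 _^_

_^_ : ℚ → ℕ → ℚ
_^_ = pow ℚ.+-*-rawSemiring

-- For k ≥ 1, these q are the rationals with n^(1+1/k) ≤ q, i.e. the
-- (closed) upper Dedekind cut of the real number n^(1+1/k).  So, for a
-- rational a > 0, x ≤ a · n^(1+1/k) + b holds exactly when x ≤ a · q + b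
-- for all such q.

UpperBound[_^1+1/_] : ℕ → ℕ → ℚ → Set
UpperBound[ n ^1+1/ k ] q = 0ℚ ℚ.≤ q × fromℕ n ^ (k ℕ.+ 1) ℚ.≤ q ^ k

{-# OPTIONS --safe #-}

-- Pass to a vertex set W, minimal among those spanning more than c|W|
-- hyperedges, so that every S ⊆ W meets at least c|S| of them, and search it
-- breadth first from a root.  Apart from the tree hyperedges, the hyperedges
-- having two vertices on the i-th level V i, for i ≤ k, number at most
-- (2k − 1)|V i|, hence c|V i| ≤ 2k|V (i+1)| + 4k|V i|: the levels grow by a
-- factor of about c/2k, and |V k| ≤ n bounds c.
--
-- If there were more, a connected part F ⊆ V i would have all degrees ≥ 2k, so
-- that paths in F grow greedily while avoiding up to 2k − 1 given vertices.  Let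
-- z be the deepest common ancestor of F, and colour F by the tree hyperedge
-- leading from z towards a vertex or, if it is always the same hyperedge g, by
-- the child of z on g.  Tree paths close bichromatic paths in F of a certain
-- length ℓ to Berge cycles of length 2k + 1; as there are none, all neighbours of
-- a vertex have the same colour, so colours alternate along a path starting with
-- a bichromatic edge.  In the first case ℓ is odd, a contradiction.  In the
-- second case ℓ is even, and the path is prolonged by the third vertex of a
-- bichromatic hyperedge, which lies on a neighbouring level, to mend its parity.
module Submission where

open import Defs
open import Algebra.Bundles using (CommutativeRing)
open import Data.Empty using (⊥; ⊥-elim)
open import Data.Fin.Base using (Fin; zero; suc; toℕ; inject₁) renaming (fromℕ to last)
open import Data.Fin.Properties as Finₚ using (any?; all?)
open import Data.Fin.Relation.Unary.Top using (view; ‵fromℕ; ‵inject₁)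
open import Data.Fin.Subset
  using (Subset; inside; outside; _∈_; _∉_; _⊆_; _∩_; _∪_; _─_; _-_; ⁅_⁆; ⊤; Nonempty; ∣_∣)
open import Data.Fin.Subset.Properties
import Data.Integer.Base as ℤ
import Data.Integer.Properties as ℤₚ
open import Data.List.Base using (List; []; _∷_; length; _++_)
open import Data.List.Properties using (length-++)
open import Data.List.Relation.Unary.All as All using (All; []; _∷_)
import Data.List.Relation.Unary.All.Properties as Allₚ
open import Data.List.Relation.Unary.AllPairs using ([]; _∷_)
open import Data.List.Relation.Unary.Unique.Propositional using (Unique)
open import Data.Nat.Base
  using (ℕ; zero; suc; NonZero; _+_; _*_; _∸_; _≤_; _<_; z≤n; s≤s; s≤s⁻¹; >-nonZero)
import Data.Nat.Base as ℕ
open import Data.Nat.DivMod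
  using (_/_; _%_; m<n⇒m%n≡m; n%n≡0; m%n<n; m/n*n≤m; m≡m%n+[m/n]*n)
open import Data.Nat.Properties
open import Data.Nat.Tactic.RingSolver using (solve-∀)
open import Data.Product.Base using (∃; ∃₂; Σ; _×_; _,_; proj₁; proj₂)
import Data.Rational.Base as ℚ
import Data.Rational.Properties as ℚₚ
import Data.Rational.Unnormalised.Base as ℚᵘ
import Data.Rational.Unnormalised.Properties as ℚᵘₚ
open import Data.Sum.Base as Sum using (_⊎_; inj₁; inj₂)
open import Data.Unit.Base using (tt) renaming (⊤ to Unit)
open import Data.Vec.Base using ([]; _∷_; tabulate; here; there)
open import Data.Vec.Properties using (lookup⇒[]=; []=⇒lookup; lookup∘tabulate)
open import Function.Base using (_∘_; id)
open import Relation.Binary.Definitions using (DecidableEquality; tri<; tri≈; tri>)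
open import Relation.Binary.PropositionalEquality
  using (_≡_; _≢_; refl; sym; trans; cong; cong₂; subst; ≢-sym; module ≡-Reasoning)
open import Relation.Nullary using (¬_; Dec; yes; no; does; contradiction)
open import Relation.Nullary.Decidable
  using (dec-true; _×-dec_; _⊎-dec_; _→-dec_; ¬?; decidable-stable)
open import Relation.Unary using (Decidable)
open import Algebra.Properties.CommutativeSemiring.Exp
  (CommutativeRing.commutativeSemiring ℚₚ.+-*-commutativeRing) using (^-distrib-*)

-- Counting in finite subsets.

select : ∀ {n} {P : Fin n → Set} → Decidable P → Subset n
select P? = tabulate (does ∘ P?)

∈-select⁺ : ∀ {n} {P : Fin n → Set} (P? : Decidable P) {x} → P x → x ∈ select P?
∈-select⁺ P? {x} px =
  lookup⇒[]= x _ (trans (lookup∘tabulate _ x) (dec-true (P? x) px))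

∈-select⁻ : ∀ {n} {P : Fin n → Set} (P? : Decidable P) {x} → x ∈ select P? → P x
∈-select⁻ P? {x} m with P? x | trans (sym (lookup∘tabulate (does ∘ P?) x)) ([]=⇒lookup m)
... | yes px | _  = px
... | no _   | ()

∣∣-injection : ∀ {a b} (p : Subset a) (q : Subset b) (f : ∀ x → x ∈ p → Fin b) →
               (∀ x m → f x m ∈ q) →
               (∀ x m y m′ → f x m ≡ f y m′ → x ≡ y) → ∣ p ∣ ≤ ∣ q ∣
∣∣-injection []            q f into inj = z≤n
∣∣-injection (outside ∷ p) q f into inj =
  ∣∣-injection p q (λ x m → f (suc x) (there m)) (λ x m → into _ _)
    (λ x m y m′ eq → Finₚ.suc-injective (inj _ _ _ _ eq))
∣∣-injection (inside ∷ p) q f into inj =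
  ≤-trans (s≤s (∣∣-injection p (q - f zero here) (λ x m → f (suc x) (there m))
                 (λ x m → x∈p∧x≢y⇒x∈p-y (into _ _) λ eq → Finₚ.0≢1+n (sym (inj _ _ _ _ eq)))
                 (λ x m y m′ eq → Finₚ.suc-injective (inj _ _ _ _ eq))))
          (x∈p⇒∣p-x∣<∣p∣ (into zero here))

∣p∪q∣≤∣p∣+∣q∣ : ∀ {n} (p q : Subset n) → ∣ p ∪ q ∣ ≤ ∣ p ∣ + ∣ q ∣
∣p∪q∣≤∣p∣+∣q∣ []            []            = z≤n
∣p∪q∣≤∣p∣+∣q∣ (outside ∷ p) (outside ∷ q) = ∣p∪q∣≤∣p∣+∣q∣ p q
∣p∪q∣≤∣p∣+∣q∣ (outside ∷ p) (inside ∷ q)  =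
  ≤-trans (s≤s (∣p∪q∣≤∣p∣+∣q∣ p q)) (≤-reflexive (sym (+-suc ∣ p ∣ ∣ q ∣)))
∣p∪q∣≤∣p∣+∣q∣ (inside ∷ p)  (outside ∷ q) = s≤s (∣p∪q∣≤∣p∣+∣q∣ p q)
∣p∪q∣≤∣p∣+∣q∣ (inside ∷ p)  (inside ∷ q)  =
  s≤s (≤-trans (∣p∪q∣≤∣p∣+∣q∣ p q) (+-monoʳ-≤ ∣ p ∣ (n≤1+n ∣ q ∣)))

⊆∪⇒∣∣≤ : ∀ {n} {p : Subset n} (q r : Subset n) → p ⊆ q ∪ r → ∣ p ∣ ≤ ∣ q ∣ + ∣ r ∣
⊆∪⇒∣∣≤ q r p⊆ = ≤-trans (p⊆q⇒∣p∣≤∣q∣ p⊆) (∣p∪q∣≤∣p∣+∣q∣ q r)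

∣p─q∣+∣q∣≤∣p∣ : ∀ {n} (p q : Subset n) → q ⊆ p → ∣ p ─ q ∣ + ∣ q ∣ ≤ ∣ p ∣
∣p─q∣+∣q∣≤∣p∣ []            []            q⊆p = z≤n
∣p─q∣+∣q∣≤∣p∣ (outside ∷ p) (outside ∷ q) q⊆p = ∣p─q∣+∣q∣≤∣p∣ p q (drop-∷-⊆ q⊆p)
∣p─q∣+∣q∣≤∣p∣ (inside ∷ p)  (outside ∷ q) q⊆p = s≤s (∣p─q∣+∣q∣≤∣p∣ p q (drop-∷-⊆ q⊆p))
∣p─q∣+∣q∣≤∣p∣ (inside ∷ p)  (inside ∷ q)  q⊆p =
  ≤-trans (≤-reflexive (+-suc ∣ p ─ q ∣ ∣ q ∣)) (s≤s (∣p─q∣+∣q∣≤∣p∣ p q (drop-∷-⊆ q⊆p)))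
∣p─q∣+∣q∣≤∣p∣ (outside ∷ p) (inside ∷ q)  q⊆p with () ← q⊆p here

x∈p─q⇒x∉q : ∀ {n} (p q : Subset n) {x} → x ∈ p ─ q → x ∉ q
x∈p─q⇒x∉q (_ ∷ p) (outside ∷ q) here      ()
x∈p─q⇒x∉q (inside ∷ p) (inside ∷ q) () here
x∈p─q⇒x∉q (outside ∷ p) (inside ∷ q) () here
x∈p─q⇒x∉q (_ ∷ p) (_ ∷ q) (there m) (there m′) = x∈p─q⇒x∉q p q m m′

∣p∣≤1+∣p-x∣ : ∀ {n} (p : Subset n) x → ∣ p ∣ ≤ suc ∣ p - x ∣
∣p∣≤1+∣p-x∣ p x =
  subst (λ m → ∣ p ∣ ≤ m + ∣ p - x ∣) (∣⁅x⁆∣≡1 x) (⊆∪⇒∣∣≤ ⁅ x ⁆ (p - x) cover)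
  where
  cover : p ⊆ ⁅ x ⁆ ∪ (p - x)
  cover {y} y∈p with y Finₚ.≟ x
  ... | yes refl = x∈p∪q⁺ (inj₁ (x∈⁅x⁆ x))
  ... | no y≢x   = x∈p∪q⁺ (inj₂ (x∈p∧x≢y⇒x∈p-y y∈p y≢x))

∣∣-unique : ∀ {n} (p : Subset n) (xs : List (Fin n)) → Unique xs → All (_∈ p) xs →
            length xs ≤ ∣ p ∣
∣∣-unique p []       _         _          = z≤n
∣∣-unique p (x ∷ xs) (x∉ ∷ u) (x∈p ∷ all) =
  ≤-trans (s≤s (∣∣-unique (p - x) xs u
                 (All.zipWith (λ (y∈p , x≢y) → x∈p∧x≢y⇒x∈p-y y∈p (x≢y ∘ sym)) (all , x∉))))
          (x∈p⇒∣p-x∣<∣p∣ x∈p)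

∣∣>0⇒nonempty : ∀ {n} (p : Subset n) → 0 < ∣ p ∣ → Nonempty p
∣∣>0⇒nonempty {n} p 0<∣p∣ with nonempty? p
... | yes ne = ne
... | no ¬ne = contradiction (trans (cong ∣_∣ (Empty-unique ¬ne)) (∣⊥∣≡0 n)) (>⇒≢ 0<∣p∣)

x∈p-y⇒x≢y : ∀ {n} (p : Subset n) y {x} → x ∈ p - y → x ≢ y
x∈p-y⇒x≢y p y m refl = x∈p─q⇒x∉q p ⁅ y ⁆ m (x∈⁅x⁆ y)

-- Minimal dense vertex sets.

module Density {n e : ℕ} (trace : Fin e → Subset n) (E : Subset e) (c : ℕ) where

  inner? : ∀ S → Decidable (λ h → h ∈ E × trace h ⊆ S)
  inner? S h = (h ∈? E) ×-dec (trace h ⊆? S)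

  -- Containment is tested on `trace h` so that the same argument serves for whole hyperedges and
  -- for their intersections with one level of the search tree.
  inner : Subset n → Subset e
  inner S = select (inner? S)

  Dense : Subset n → Set
  Dense S = c * ∣ S ∣ < ∣ inner S ∣

  MinimalDense : Subset n → Set
  MinimalDense W = Dense W × (∀ S → ∣ S ∣ < ∣ W ∣ → ¬ Dense S)

  minimalDense : ∀ S → Dense S → ∃ MinimalDense
  minimalDense S = go ∣ S ∣ S ≤-refl
    where
    go : ∀ m S → ∣ S ∣ ≤ m → Dense S → ∃ MinimalDense
    go m S S≤m d with anySubset? (λ T → (∣ T ∣ <? ∣ S ∣) ×-dec (c * ∣ T ∣ <? ∣ inner T ∣))
    go m       S S≤m d | no ¬smaller = S , d , λ T lt d′ → ¬smaller (T , lt , d′)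
    go zero    S S≤m d | yes (T , lt , d′) with () ← ≤-trans lt S≤m
    go (suc m) S S≤m d | yes (T , lt , d′) = go m T (s≤s⁻¹ (≤-trans lt S≤m)) d′

  touching? : ∀ W S → Decidable (λ h → h ∈ inner W × ∃ λ x → x ∈ trace h × x ∈ S)
  touching? W S h = (h ∈? inner W) ×-dec any? λ x → (x ∈? trace h) ×-dec (x ∈? S)

  touching : Subset n → Subset n → Subset e
  touching W S = select (touching? W S)

  module Minimal {W : Subset n} (minimal : MinimalDense W) where

    smaller : ∀ S → ∣ S ∣ < ∣ W ∣ → ∣ inner S ∣ ≤ c * ∣ S ∣
    smaller S lt = ≮⇒≥ (proj₂ minimal S lt)

    ∣W─S∣<∣W∣ : ∀ S → S ⊆ W → Nonempty S → ∣ W ─ S ∣ < ∣ W ∣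
    ∣W─S∣<∣W∣ S S⊆W (x , x∈S) =
      p∩q≢∅⇒∣p─q∣<∣p∣ W S (x , x∈p∩q⁺ (S⊆W x∈S , x∈S))

    split : ∀ S → S ⊆ W → c * ∣ W ─ S ∣ + c * ∣ S ∣ ≤ c * ∣ W ∣
    split S S⊆W = ≤-trans (≤-reflexive (sym (*-distribˡ-+ c ∣ W ─ S ∣ ∣ S ∣)))
                          (*-monoʳ-≤ c (∣p─q∣+∣q∣≤∣p∣ W S S⊆W))

    -- Otherwise deleting `S` from `W` would leave a smaller dense set.
    touching-bound : ∀ S → S ⊆ W → Nonempty S → c * ∣ S ∣ < ∣ touching W S ∣
    touching-bound S S⊆W ne = +-cancelˡ-< (c * ∣ W ─ S ∣) _ _ (begin-strict
      c * ∣ W ─ S ∣ + c * ∣ S ∣            ≤⟨ split S S⊆W ⟩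
      c * ∣ W ∣                            <⟨ proj₁ minimal ⟩
      ∣ inner W ∣                          ≤⟨ ⊆∪⇒∣∣≤ (inner (W ─ S)) (touching W S) cover ⟩
      ∣ inner (W ─ S) ∣ + ∣ touching W S ∣ ≤⟨ +-monoˡ-≤ _ (smaller (W ─ S) (∣W─S∣<∣W∣ S S⊆W ne)) ⟩
      c * ∣ W ─ S ∣ + ∣ touching W S ∣     ∎)
      where
      open ≤-Reasoning
      cover : inner W ⊆ inner (W ─ S) ∪ touching W S
      cover {h} h∈ with any? (λ x → (x ∈? trace h) ×-dec (x ∈? S))
      ... | yes meet = x∈p∪q⁺ (inj₂ (∈-select⁺ (touching? W S) (h∈ , meet)))
      ... | no ¬meet =
        let h∈E , tr⊆ = ∈-select⁻ (inner? W) h∈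
        in x∈p∪q⁺ (inj₁ (∈-select⁺ (inner? (W ─ S))
             (h∈E , λ {x} x∈tr → x∈p∧x∉q⇒x∈p─q (tr⊆ x∈tr) λ x∈S → ¬meet (x , x∈tr , x∈S))))

    -- Without a crossing hyperedge, every hyperedge inside `W` would lie in the part where `Q`
    -- holds or in the rest. Both parts are smaller than `W`, hence not dense, and their two bounds
    -- add up to one that contradicts the density of `W`.
    connected : ∀ {Q : Fin n → Set} → Decidable Q →
                ∀ {x y} → x ∈ W → Q x → y ∈ W → ¬ Q y →
                ∃ λ h → h ∈ inner W × ∃₂ λ u v → u ∈ trace h × v ∈ trace h × Q u × ¬ Q v
    connected {Q} Q? {x} {y} x∈W qx y∈W ¬qy
      with any? (λ h → (h ∈? inner W) ×-dec any? (λ u → any? (λ v →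
             (u ∈? trace h) ×-dec (v ∈? trace h) ×-dec Q? u ×-dec ¬? (Q? v))))
    ... | yes crossing = crossing
    ... | no ¬crossing = ⊥-elim (<⇒≱ (proj₁ minimal) (begin
      ∣ inner W ∣                        ≤⟨ ⊆∪⇒∣∣≤ (inner (W ─ S)) (inner S) cover ⟩
      ∣ inner (W ─ S) ∣ + ∣ inner S ∣    ≤⟨ +-mono-≤ (smaller (W ─ S) (∣W─S∣<∣W∣ S S⊆W (x , x∈S)))
                                                   (smaller S ∣S∣<∣W∣) ⟩
      c * ∣ W ─ S ∣ + c * ∣ S ∣          ≤⟨ split S S⊆W ⟩
      c * ∣ W ∣                          ∎))
      where
      open ≤-Reasoning
      S? : Decidable (λ z → z ∈ W × Q z)
      S? z = (z ∈? W) ×-dec Q? z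
      S : Subset n
      S = select S?
      x∈S : x ∈ S
      x∈S = ∈-select⁺ S? (x∈W , qx)
      S⊆W : S ⊆ W
      S⊆W z∈S = proj₁ (∈-select⁻ S? z∈S)
      ∣S∣<∣W∣ : ∣ S ∣ < ∣ W ∣
      ∣S∣<∣W∣ = p⊂q⇒∣p∣<∣q∣ (S⊆W , y , y∈W , λ y∈S → ¬qy (proj₂ (∈-select⁻ S? y∈S)))
      cover : inner W ⊆ inner (W ─ S) ∪ inner S
      cover {h} h∈ with ∈-select⁻ (inner? W) h∈ | any? (λ u → (u ∈? trace h) ×-dec Q? u)
      ... | h∈E , tr⊆ | yes (u , u∈ , qu) =
        x∈p∪q⁺ (inj₂ (∈-select⁺ (inner? S) (h∈E , λ {v} v∈ → ∈-select⁺ S?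
          (tr⊆ v∈ , decidable-stable (Q? v) λ ¬qv → ¬crossing (h , h∈ , u , v , u∈ , v∈ , qu , ¬qv)))))
      ... | h∈E , tr⊆ | no ¬q =
        x∈p∪q⁺ (inj₁ (∈-select⁺ (inner? (W ─ S)) (h∈E , λ {v} v∈ →
          x∈p∧x∉q⇒x∈p─q (tr⊆ v∈) λ v∈S → ¬q (v , v∈ , proj₂ (∈-select⁻ S? v∈S)))))

-- Walks and Berge cycles.

next-inject₁ : ∀ {m} (i : Fin m) → next (inject₁ i) ≡ suc i
next-inject₁ {m} i = Finₚ.toℕ-injective (begin
  toℕ (next (inject₁ i))        ≡⟨ Finₚ.toℕ-fromℕ< _ ⟩
  suc (toℕ (inject₁ i)) % suc m ≡⟨ cong (λ j → suc j % suc m) (Finₚ.toℕ-inject₁ i) ⟩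
  suc (toℕ i) % suc m           ≡⟨ m<n⇒m%n≡m (s≤s (Finₚ.toℕ<n i)) ⟩
  suc (toℕ i)                   ∎)
  where open ≡-Reasoning

next-fromℕ : ∀ m → next (last m) ≡ zero
next-fromℕ m = Finₚ.toℕ-injective (begin
  toℕ (next (last m))        ≡⟨ Finₚ.toℕ-fromℕ< _ ⟩
  suc (toℕ (last m)) % suc m ≡⟨ cong (λ j → suc j % suc m) (Finₚ.toℕ-fromℕ m) ⟩
  suc m % suc m               ≡⟨ n%n≡0 (suc m) ⟩
  0                           ∎)
  where open ≡-Reasoning

module Walks {n e : ℕ} (edge : Fin e → Subset n) where

  data Walk : Fin n → Fin n → ℕ → Set where
    stop : ∀ {x} → Walk x x 0
    step : ∀ {x y z ℓ} h → x ∈ edge h → y ∈ edge h → Walk y z ℓ → Walk x z (suc ℓ)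

  AllV : (Fin n → Set) → ∀ {x y ℓ} → Walk x y ℓ → Set
  AllV P (stop {x})           = P x
  AllV P (step {x} _ _ _ w)   = P x × AllV P w

  AllE : (Fin e → Set) → ∀ {x y ℓ} → Walk x y ℓ → Set
  AllE P stop           = Unit
  AllE P (step h _ _ w) = P h × AllE P w

  Distinct : ∀ {x y ℓ} → Walk x y ℓ → Set
  Distinct stop               = Unit
  Distinct (step {x} h _ _ w) = AllV (x ≢_) w × AllE (h ≢_) w × Distinct w

  mapV : ∀ {P Q : Fin n → Set} → (∀ {x} → P x → Q x) →
         ∀ {x y ℓ} (w : Walk x y ℓ) → AllV P w → AllV Q w
  mapV f stop           p        = f p
  mapV f (step _ _ _ w) (p , ps) = f p , mapV f w ps

  mapE : ∀ {P Q : Fin e → Set} → (∀ {h} → P h → Q h) →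
         ∀ {x y ℓ} (w : Walk x y ℓ) → AllE P w → AllE Q w
  mapE f stop           _        = tt
  mapE f (step _ _ _ w) (p , ps) = f p , mapE f w ps

  headV : ∀ {P : Fin n → Set} {x y ℓ} (w : Walk x y ℓ) → AllV P w → P x
  headV stop           p       = p
  headV (step _ _ _ w) (p , _) = p

  lastV : ∀ {P : Fin n → Set} {x y ℓ} (w : Walk x y ℓ) → AllV P w → P y
  lastV stop           p        = p
  lastV (step _ _ _ w) (_ , ps) = lastV w ps

  snoc : ∀ {x y z ℓ} → Walk x y ℓ → ∀ h → y ∈ edge h → z ∈ edge h → Walk x z (suc ℓ)
  snoc stop              g y∈ z∈ = step g y∈ z∈ stop
  snoc (step h x∈ x′∈ w) g y∈ z∈ = step h x∈ x′∈ (snoc w g y∈ z∈)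

  snocV : ∀ {P : Fin n → Set} {x y z ℓ} (w : Walk x y ℓ) h (y∈ : y ∈ edge h) (z∈ : z ∈ edge h) →
          AllV P w → P z → AllV P (snoc w h y∈ z∈)
  snocV stop           g y∈ z∈ p        pz = p , pz
  snocV (step _ _ _ w) g y∈ z∈ (p , ps) pz = p , snocV w g y∈ z∈ ps pz

  snocE : ∀ {P : Fin e → Set} {x y z ℓ} (w : Walk x y ℓ) h (y∈ : y ∈ edge h) (z∈ : z ∈ edge h) →
          AllE P w → P h → AllE P (snoc w h y∈ z∈)
  snocE stop           g y∈ z∈ _        pg = pg , tt
  snocE (step _ _ _ w) g y∈ z∈ (p , ps) pg = p , snocE w g y∈ z∈ ps pg

  snocDistinct : ∀ {x y z ℓ} (w : Walk x y ℓ) h (y∈ : y ∈ edge h) (z∈ : z ∈ edge h) →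
                 Distinct w → AllV (_≢ z) w → AllE (_≢ h) w → Distinct (snoc w h y∈ z∈)
  snocDistinct stop           g y∈ z∈ _            z≢ _ = z≢ , tt , tt
  snocDistinct (step h _ _ w) g y∈ z∈ (dv , de , d) (x≢z , z≢) (h≢g , g≢) =
    snocV w g y∈ z∈ dv x≢z , snocE w g y∈ z∈ de h≢g , snocDistinct w g y∈ z∈ d z≢ g≢

  vert : ∀ {x y ℓ} → Walk x y ℓ → Fin (suc ℓ) → Fin n
  vert {x} _              zero    = x
  vert     (step _ _ _ w) (suc i) = vert w i

  vert-all : ∀ {P x y ℓ} (w : Walk x y ℓ) → AllV P w → ∀ i → P (vert w i)
  vert-all w              ps       zero    = headV w ps
  vert-all (step _ _ _ w) (_ , ps) (suc i) = vert-all w ps i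

  vert-injective : ∀ {x y ℓ} (w : Walk x y ℓ) → Distinct w →
                   ∀ {i j} → vert w i ≡ vert w j → i ≡ j
  vert-injective w              d {zero}  {zero}  eq = refl
  vert-injective (step _ _ _ w) (dv , _) {zero} {suc j} eq = contradiction eq (vert-all w dv j)
  vert-injective (step _ _ _ w) (dv , _) {suc i} {zero} eq = contradiction (sym eq) (vert-all w dv i)
  vert-injective (step _ _ _ w) (_ , _ , d) {suc i} {suc j} eq = cong suc (vert-injective w d eq)

  closedEdge : ∀ {x y ℓ} → Walk x y ℓ → Fin e → Fin (suc ℓ) → Fin e
  closedEdge stop           g zero    = g
  closedEdge (step h _ _ w) g zero    = h
  closedEdge (step h _ _ w) g (suc i) = closedEdge w g i

  closedEdge-all : ∀ {P : Fin e → Set} {x y ℓ} (w : Walk x y ℓ) {g} → AllE P w → P g →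
                   ∀ i → P (closedEdge w g i)
  closedEdge-all stop           _        pg zero    = pg
  closedEdge-all (step _ _ _ w) (p , _)  pg zero    = p
  closedEdge-all (step _ _ _ w) (_ , ps) pg (suc i) = closedEdge-all w ps pg i

  closedEdge-injective : ∀ {x y ℓ} (w : Walk x y ℓ) {g} → Distinct w → AllE (_≢ g) w →
                         ∀ {i j} → closedEdge w g i ≡ closedEdge w g j → i ≡ j
  closedEdge-injective stop d g≢ {zero} {zero} eq = refl
  closedEdge-injective (step _ _ _ w) d g≢ {zero} {zero} eq = refl
  closedEdge-injective (step _ _ _ w) (_ , de , _) (h≢g , _) {zero} {suc j} eq =
    contradiction eq (closedEdge-all w de h≢g j)
  closedEdge-injective (step _ _ _ w) (_ , de , _) (h≢g , _) {suc i} {zero} eq =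
    contradiction (sym eq) (closedEdge-all w de h≢g i)
  closedEdge-injective (step _ _ _ w) (_ , _ , d) (_ , g≢) {suc i} {suc j} eq =
    cong suc (closedEdge-injective w d g≢ eq)

  closedEdge-source : ∀ {x y ℓ} (w : Walk x y ℓ) {g} → y ∈ edge g →
                      ∀ i → vert w i ∈ edge (closedEdge w g i)
  closedEdge-source stop             y∈ zero    = y∈
  closedEdge-source (step _ x∈ _ w)  y∈ zero    = x∈
  closedEdge-source (step _ _ _ w)   y∈ (suc i) = closedEdge-source w y∈ i

  closedEdge-target : ∀ {x y ℓ} (w : Walk x y ℓ) {g} →
                      ∀ (i : Fin ℓ) → vert w (suc i) ∈ edge (closedEdge w g (inject₁ i))
  closedEdge-target (step _ _ y∈ w) zero    = y∈
  closedEdge-target (step _ _ _ w)  (suc i) = closedEdge-target w i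

  closedEdge-last : ∀ {x y ℓ} (w : Walk x y ℓ) {g} → closedEdge w g (last ℓ) ≡ g
  closedEdge-last stop           = refl
  closedEdge-last (step _ _ _ w) = closedEdge-last w

  -- The `ℓ + 1` vertices of the walk are those of the cycle, and `g` is the one hyperedge still
  -- missing; `next` wraps round exactly at the last index, where `g` stands.
  close : ∀ {x y ℓ} (w : Walk x y ℓ) g → Distinct w → AllE (_≢ g) w →
          x ∈ edge g → y ∈ edge g → HasBergeCycle (suc ℓ) edge
  close {ℓ = ℓ} w g d g≢ x∈ y∈ =
    closedEdge w g , vert w ,
    isBergeCycle (closedEdge-injective w d g≢) (vert-injective w d)
                 (λ i → closedEdge-source w y∈ i , target i)
    where
    target : ∀ i → vert w (next i) ∈ edge (closedEdge w g i)
    target i with view i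
    ... | ‵fromℕ     = subst (λ j → vert w j ∈ edge (closedEdge w g (last ℓ))) (sym (next-fromℕ ℓ))
                         (subst (λ h → _ ∈ edge h) (sym (closedEdge-last w)) x∈)
    ... | ‵inject₁ j = subst (λ m → vert w m ∈ edge (closedEdge w g (inject₁ j)))
                         (sym (next-inject₁ j)) (closedEdge-target w j)

-- 2 * m, in a form that computes to two successors on suc m.
dbl : ℕ → ℕ
dbl zero    = 0
dbl (suc m) = suc (suc (dbl m))

dbl-+ : ∀ a b → dbl (a + b) ≡ dbl a + dbl b
dbl-+ zero    b = refl
dbl-+ (suc a) b = cong (λ m → suc (suc m)) (dbl-+ a b)

dbl≡2* : ∀ m → dbl m ≡ 2 * m
dbl≡2* zero    = refl
dbl≡2* (suc m) = cong suc (trans (cong suc (dbl≡2* m)) (sym (+-suc m (m + 0))))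

dbl-mono-≤ : ∀ {a b} → a ≤ b → dbl a ≤ dbl b
dbl-mono-≤ z≤n     = z≤n
dbl-mono-≤ (s≤s p) = s≤s (s≤s (dbl-mono-≤ p))

-- Descending from `i` keeps a failure of `P` just above the candidate. Applied to separation by
-- ancestors, this locates the deepest common ancestor.
last-true : ∀ {P : ℕ → Set} → Decidable P → ∀ i → P 0 → ¬ P i →
            ∃ λ t → t < i × P t × ¬ P (suc t)
last-true P? zero    p0 ¬pi = contradiction p0 ¬pi
last-true P? (suc i) p0 ¬pi with P? i
... | yes pi = i , ≤-refl , pi , ¬pi
... | no ¬p  = let t , t<i , rest = last-true P? i p0 ¬p in t , m<n⇒m<1+n t<i , rest

-- Linear 3-uniform hypergraphs and search trees.

module Linear3Graph {n e : ℕ} (edge : Fin e → Subset n) (linear : Linear edge)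
                    (uniform : ∀ h → ∣ edge h ∣ ≡ 3) where

  open Walks edge public

  meet-once : ∀ {x y g h} → x ≢ y → x ∈ edge g → y ∈ edge g → x ∈ edge h → y ∈ edge h → g ≡ h
  meet-once {x} {y} {g} {h} x≢y x∈g y∈g x∈h y∈h = decidable-stable (g Finₚ.≟ h) λ g≢h →
    contradiction (≤-trans
      (∣∣-unique (edge g ∩ edge h) (x ∷ y ∷ []) ((x≢y ∷ []) ∷ [] ∷ [])
                 (x∈p∩q⁺ (x∈g , x∈h) ∷ x∈p∩q⁺ (y∈g , y∈h) ∷ []))
      (linear g h g≢h)) λ { (s≤s ()) }

  third : ∀ h u v → ∃ λ w → w ∈ edge h × w ≢ u × w ≢ v
  third h u v =
    let w , w∈ = ∣∣>0⇒nonempty (edge h - u - v) (s≤s⁻¹ (s≤s⁻¹ (≤-trans (≤-reflexive (sym (uniform h)))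
                   (≤-trans (∣p∣≤1+∣p-x∣ (edge h) u) (s≤s (∣p∣≤1+∣p-x∣ (edge h - u) v))))))
        w∈′ = p─q⊆p (edge h - u) ⁅ v ⁆ w∈
    in w , p─q⊆p (edge h) ⁅ u ⁆ w∈′ , x∈p-y⇒x≢y (edge h) u w∈′ , x∈p-y⇒x≢y (edge h - u) v w∈

  not-four : ∀ {h a b c d} → a ∈ edge h → b ∈ edge h → c ∈ edge h → d ∈ edge h →
             a ≢ b → a ≢ c → a ≢ d → b ≢ c → b ≢ d → c ≢ d → ⊥
  not-four {h} {a} {b} {c} {d} a∈ b∈ c∈ d∈ ab ac ad bc bd cd =
    contradiction (≤-trans
      (∣∣-unique (edge h) (a ∷ b ∷ c ∷ d ∷ [])
        ((ab ∷ ac ∷ ad ∷ []) ∷ (bc ∷ bd ∷ []) ∷ (cd ∷ []) ∷ [] ∷ []) (a∈ ∷ b∈ ∷ c∈ ∷ d∈ ∷ []))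
      (≤-reflexive (uniform h))) λ { (s≤s (s≤s (s≤s ()))) }

  -- The distance from the root is exact only up to k (larger ones are merely > k),
  -- and par and link carry information only at distances from 1 to k.
  record SearchTree (A : Subset e) (k : ℕ) : Set where
    field
      root      : Fin n
      dist      : Fin n → ℕ
      par       : Fin n → Fin n
      link      : Fin n → Fin e
      lipschitz : ∀ {h x y} → h ∈ A → x ∈ edge h → y ∈ edge h → dist x ≤ suc (dist y)
      dist-root : dist root ≡ 0
      dist≡0    : ∀ {x} → dist x ≡ 0 → x ≡ root
      link∈A    : ∀ {x i} → dist x ≡ suc i → i < k → link x ∈ A
      ∈link     : ∀ {x i} → dist x ≡ suc i → i < k → x ∈ edge (link x)
      par∈link  : ∀ {x i} → dist x ≡ suc i → i < k → par x ∈ edge (link x)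
      dist-par  : ∀ {x i} → dist x ≡ suc i → i < k → dist (par x) ≡ i

  -- Closing paths through the tree.

  module Ascent {A : Subset e} {k : ℕ} (T : SearchTree A k)
                (acyclic : ¬ HasBergeCycle (suc (dbl k)) edge) where
    open SearchTree T

    -- Tree paths from level `i` to the root use only links of vertices on the levels 1 to `i`, so a
    -- hyperedge with this property never recurs on them.
    FreeUpTo : ℕ → Fin e → Set
    FreeUpTo i h = ∀ u j → dist u ≡ suc j → j < i → link u ≢ h

    FreeUpTo-mono : ∀ {i j h} → i ≤ j → FreeUpTo j h → FreeUpTo i h
    FreeUpTo-mono i≤j free u j du lt = free u j du (≤-trans lt i≤j)

    -- The link of `u` contains `par u` on level `j`, so all its vertices are at distance at most
    -- `j + 1` from the root; `x` is farther away.
    link-free : ∀ {x i} → dist x ≡ suc i → i < k → FreeUpTo i (link x)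
    link-free {x} {i} dx i<k u j du j<i eq = <⇒≱ j<i (s≤s⁻¹ (begin
      suc i              ≡⟨ sym dx ⟩
      dist x             ≤⟨ lipschitz (link∈A du j<k) (subst (λ h → x ∈ edge h) (sym eq) (∈link dx i<k))
                                      (par∈link du j<k) ⟩
      suc (dist (par u)) ≡⟨ cong suc (dist-par du j<k) ⟩
      suc j              ∎))
      where
      open ≤-Reasoning
      j<k = <-trans j<i i<k

    -- Otherwise `x`, `y` and their two parents would be four vertices of one hyperedge.
    same-link⇒same-par : ∀ {x y i} → x ≢ y → dist x ≡ suc i → dist y ≡ suc i → i < k →
                         link x ≡ link y → par x ≡ par y
    same-link⇒same-par {x} {y} {i} x≢y dx dy i<k eq = decidable-stable (par x Finₚ.≟ par y) λ px≢py →
      not-four (∈link dx i<k) (at (∈link dy i<k)) (par∈link dx i<k) (at (par∈link dy i<k))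
        x≢y (below dx dx) (below dx dy) (below dy dx) (below dy dy) px≢py
      where
      at : ∀ {z} → z ∈ edge (link y) → z ∈ edge (link x)
      at = subst (λ h → _ ∈ edge h) (sym eq)
      below : ∀ {v w} → dist v ≡ suc i → dist w ≡ suc i → v ≢ par w
      below dv dw v≡pw = 1+n≢n (trans (sym dv) (trans (cong dist v≡pw) (dist-par dw i<k)))

    -- Conn x y τ: the tree paths from x and y (on the same level) up to where
    -- they meet join into a Berge path of length τ; two children of a vertex
    -- that hang on a common hyperedge are joined by that hyperedge alone.
    data Conn : Fin n → Fin n → ℕ → Set where
      shared : ∀ {x y} → x ≢ y → par x ≡ par y → link x ≡ link y → Conn x y 1
      fork   : ∀ {x y} → x ≢ y → par x ≡ par y → link x ≢ link y → Conn x y 2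
      up     : ∀ {x y τ} → par x ≢ par y → Conn (par x) (par y) τ → Conn x y (2 + τ)

    conn-≢ : ∀ {x y τ} → Conn x y τ → x ≢ y
    conn-≢ (shared x≢y _ _) = x≢y
    conn-≢ (fork x≢y _ _)   = x≢y
    conn-≢ (up px≢py _)     = px≢py ∘ cong par

    closed : ∀ {x y ℓ} (w : Walk x y ℓ) g → Distinct w → AllE (_≢ g) w →
             x ∈ edge g → y ∈ edge g → ℓ ≡ dbl k → ⊥
    closed w g d g≢ x∈ y∈ refl = acyclic (close w g d g≢ x∈ y∈)

    -- In the case `up`, the links of both ends lengthen the walk by the 2 that `τ` loses, so
    -- `ℓ + τ` is kept. The parents are new because the walk stays at distance at least `i`, the
    -- links because its hyperedges are `FreeUpTo i`. Once the ends have a common parent, their one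
    -- or two links close the walk.
    ascend : ∀ i → i ≤ k → ∀ {x y ℓ τ} → dist x ≡ i → dist y ≡ i → (w : Walk x y ℓ) →
             Distinct w → AllV (λ v → i ≤ dist v) w → AllE (FreeUpTo i) w →
             Conn x y τ → ℓ + τ ≡ suc (dbl k) → ⊥
    ascend zero    _   dx dy w d lv fr c len = conn-≢ c (trans (dist≡0 dx) (sym (dist≡0 dy)))
    ascend (suc i) i<k {x} {y} {ℓ} dx dy w d lv fr c len = go c len
      where
      fresh-link : ∀ {v} → dist v ≡ suc i → AllE (link v ≢_) w
      fresh-link dv = mapE (λ free → free _ _ dv ≤-refl) w fr
      fresh-par : ∀ {v} → dist v ≡ suc i → AllV (par v ≢_) w
      fresh-par dv = mapV (λ {z} le eq → <⇒≢ le (trans (sym (dist-par dv i<k)) (cong dist eq))) w lv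
      w₁ : Walk (par x) y (suc ℓ)
      w₁ = step (link x) (par∈link dx i<k) (∈link dx i<k) w
      d₁ : Distinct w₁
      d₁ = fresh-par dx , fresh-link dx , d
      go : ∀ {τ} → Conn x y τ → ℓ + τ ≡ suc (dbl k) → ⊥
      go (shared _ _ lx≡ly) len =
        closed w (link x) d (mapE ≢-sym w (fresh-link dx)) (∈link dx i<k)
          (subst (λ h → y ∈ edge h) (sym lx≡ly) (∈link dy i<k))
          (suc-injective (trans (sym (+-comm ℓ 1)) len))
      go (fork _ px≡py lx≢ly) len =
        closed w₁ (link y) d₁ (lx≢ly , mapE ≢-sym w (fresh-link dy))
          (subst (λ v → v ∈ edge (link y)) (sym px≡py) (par∈link dy i<k)) (∈link dy i<k)
          (suc-injective (trans (sym (+-comm ℓ 2)) len))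
      go {suc (suc τ)} (up px≢py c) len =
        ascend i (<⇒≤ i<k) (dist-par dx i<k) (dist-par dy i<k)
          (snoc w₁ (link y) (∈link dy i<k) (par∈link dy i<k))
          (snocDistinct w₁ (link y) _ _ d₁ (px≢py , mapV ≢-sym w (fresh-par dy))
            (lx≢ly , mapE ≢-sym w (fresh-link dy)))
          (snocV w₁ (link y) _ _
            (≤-reflexive (sym (dist-par dx i<k)) , mapV <⇒≤ w lv)
            (≤-reflexive (sym (dist-par dy i<k))))
          (snocE w₁ (link y) _ _
            (link-free dx i<k , mapE (FreeUpTo-mono (n≤1+n i)) w fr) (link-free dy i<k))
          c (trans (sym (trans (+-suc ℓ (suc τ)) (cong suc (+-suc ℓ τ)))) len)
        where
        lx≢ly : link x ≢ link y
        lx≢ly eq = px≢py (same-link⇒same-par (px≢py ∘ cong par) dx dy i<k eq)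

    anc : ℕ → Fin n → Fin n
    anc zero    x = x
    anc (suc t) x = anc t (par x)

    par-anc : ∀ t x → par (anc t x) ≡ anc (suc t) x
    par-anc zero    x = refl
    par-anc (suc t) x = par-anc t (par x)

    dist-anc : ∀ t {i x} → dist x ≡ t + i → t + i ≤ k → dist (anc t x) ≡ i
    dist-anc zero    dx i≤k = dx
    dist-anc (suc t) dx i<k = dist-anc t (dist-par dx i<k) (<⇒≤ i<k)

    conn-anc : ∀ t {x y τ} → Conn (anc t x) (anc t y) τ → Conn x y (dbl t + τ)
    conn-anc zero    c = c
    conn-anc (suc t) c = up (conn-≢ c ∘ cong (anc t)) (conn-anc t c)

    -- Both tree paths end at the root, so they meet after at most `i` steps on each side.
    conn-total : ∀ i → i ≤ k → ∀ {x y} → dist x ≡ i → dist y ≡ i → x ≢ y →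
                 ∃ λ τ → τ ≤ dbl i × Conn x y τ
    conn-total zero    _   dx dy x≢y = contradiction (trans (dist≡0 dx) (sym (dist≡0 dy))) x≢y
    conn-total (suc i) i<k {x} {y} dx dy x≢y with par x Finₚ.≟ par y | link x Finₚ.≟ link y
    ... | yes p | yes l = 1 , s≤s z≤n , shared x≢y p l
    ... | yes p | no l  = 2 , s≤s (s≤s z≤n) , fork x≢y p l
    ... | no p  | _     =
      let τ , τ≤ , c = conn-total i (<⇒≤ i<k) (dist-par dx i<k) (dist-par dy i<k) p
      in 2 + τ , s≤s (s≤s τ≤) , up p c

-- Paths and colours inside one level.

module LevelGraph
  {n e : ℕ} (edge : Fin e → Subset n) (linear : Linear edge) (uniform : ∀ h → ∣ edge h ∣ ≡ 3)
  (A : Subset e) (k : ℕ) (T : Linear3Graph.SearchTree edge linear uniform A k)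
  (acyclic : ¬ HasBergeCycle (suc (dbl k)) edge) where

  open Linear3Graph edge linear uniform
  open SearchTree T
  open Ascent T acyclic

  -- The properties of a minimal dense part of level `i` on which the path arguments rest. `avoid`
  -- stands for degrees of at least `2k`: by linearity each listed vertex spoils at most one
  -- hyperedge through `v`. `low` ensures that a third vertex on level `i + 1` still has a parent in
  -- the tree.
  record LevelSubgraph (i : ℕ) : Set₁ where
    field
      i≤k     : i ≤ k
      W       : Subset n
      N       : Subset e
      level   : ∀ {x} → x ∈ W → dist x ≡ i
      inA     : ∀ {h} → h ∈ N → h ∈ A
      free    : ∀ {h} → h ∈ N → FreeUpTo k h
      low     : ∀ {h x} → h ∈ N → x ∈ edge h → dist x ≤ k
      full    : ∀ {h x} → h ∈ N → x ∈ edge h → dist x ≡ i → x ∈ W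
      another : ∀ {h} → h ∈ N → ∀ v → ∃ λ u → u ≢ v × u ∈ edge h × u ∈ W
      avoid   : ∀ {v} → v ∈ W → (L : List (Fin n)) → All (v ≢_) L → length L < dbl k →
                ∃ λ h → h ∈ N × v ∈ edge h × All (_∉ edge h) L
      connect : {Q : Fin n → Set} → Decidable Q → ∀ {x y} → x ∈ W → Q x → y ∈ W → ¬ Q y →
                ∃ λ h → h ∈ N × ∃₂ λ u v → u ∈ edge h × v ∈ edge h × u ∈ W × v ∈ W × Q u × ¬ Q v

  module Within {i : ℕ} (G : LevelSubgraph i) where
    open LevelSubgraph G

    tail : ∀ {x y ℓ} → Walk x y ℓ → List (Fin n)
    tail stop                = []
    tail (step {y = y} _ _ _ w) = y ∷ tail w

    length-tail : ∀ {x y ℓ} (w : Walk x y ℓ) → length (tail w) ≡ ℓ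
    length-tail stop           = refl
    length-tail (step _ _ _ w) = cong suc (length-tail w)

    AllV⇒All : ∀ {P x y ℓ} (w : Walk x y ℓ) → AllV P w → All P (x ∷ tail w)
    AllV⇒All stop           p        = p ∷ []
    AllV⇒All (step _ _ _ w) (p , ps) = p ∷ AllV⇒All w ps

    All⇒AllV : ∀ {P x y ℓ} (w : Walk x y ℓ) → P x → All P (tail w) → AllV P w
    All⇒AllV stop           p _        = p
    All⇒AllV (step _ _ _ w) p (q ∷ qs) = p , All⇒AllV w q qs

    distinct⇒head≢tail : ∀ {x y ℓ} (w : Walk x y ℓ) → Distinct w → All (x ≢_) (tail w)
    distinct⇒head≢tail stop           _        = []
    distinct⇒head≢tail (step _ _ _ w) (dv , _) = AllV⇒All w dv

    avoids-tail⇒≢ : ∀ {x y ℓ h} (w : Walk x y ℓ) → All (_∉ edge h) (tail w) → AllE (h ≢_) w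
    avoids-tail⇒≢ stop             _          = tt
    avoids-tail⇒≢ (step g _ y∈g w) (y∉h ∷ ∉h) = (λ { refl → y∉h y∈g }) , avoids-tail⇒≢ w ∉h

    -- `L` lists the vertices reserved for prolonging the walk later.
    record Clean (L : List (Fin n)) {x y ℓ} (w : Walk x y ℓ) : Set where
      field
        distinct : Distinct w
        verts    : AllV (λ v → v ∈ W × All (v ≢_) L) w
        edges    : AllE (λ h → h ∈ N × All (_∉ edge h) L) w

    -- The path is built greedily at its head, so that `v` remains an end to which a further
    -- hyperedge can be attached.
    grow : ∀ s {v} L → v ∈ W → All (v ≢_) L → length L + s ≤ dbl k →
           ∃ λ u → Σ (Walk u v s) (Clean L)
    grow zero    {v} L v∈W v∉L _   = v , stop , record { distinct = tt ; verts = v∈W , v∉L ; edges = tt }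
    grow (suc s) {v} L v∈W v∉L len
      with grow s L v∈W v∉L (≤-trans (+-monoʳ-≤ (length L) (n≤1+n s)) len)
    -- The new hyperedge has to pass through `u` but avoids the rest of the path. As each earlier
    -- hyperedge contains a vertex of `tail w`, it differs from all of them.
    ... | u , w , cl
      with avoid (proj₁ (headV w (Clean.verts cl))) (tail w ++ L)
             (Allₚ.++⁺ (distinct⇒head≢tail w (Clean.distinct cl)) (proj₂ (headV w (Clean.verts cl))))
             (≤-trans (≤-reflexive (cong suc (trans (length-++ (tail w))
                (trans (cong (_+ length L) (length-tail w)) (+-comm s (length L))))))
               (≤-trans (≤-reflexive (sym (+-suc (length L) s))) len))
    ... | h , h∈N , u∈h , ∉h
      with another h∈N u
    ... | u′ , u′≢u , u′∈h , u′∈W =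
      let tail∉ , L∉ = Allₚ.++⁻ (tail w) ∉h
          ≢-off : ∀ {z} → z ∉ edge h → u′ ≢ z
          ≢-off = λ { z∉h refl → z∉h u′∈h }
      in u′ , step h u′∈h u∈h w , record
        { distinct = All⇒AllV w u′≢u (All.map ≢-off tail∉) , avoids-tail⇒≢ w tail∉ , Clean.distinct cl
        ; verts    = (u′∈W , All.map ≢-off L∉) , Clean.verts cl
        ; edges    = (h∈N , L∉) , Clean.edges cl
        }

    finish : ∀ {x y ℓ τ} (w : Walk x y ℓ) → Distinct w → AllV (_∈ W) w → AllE (_∈ N) w →
             Conn x y τ → ℓ + τ ≡ suc (dbl k) → ⊥
    finish w d v∈ h∈ =
      ascend i i≤k (level (headV w v∈)) (level (lastV w v∈)) w d
        (mapV (λ x∈ → ≤-reflexive (sym (level x∈))) w v∈)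
        (mapE (λ h∈N → FreeUpTo-mono i≤k (free h∈N)) w h∈)

    finish-snoc : ∀ {x y z ℓ τ L h} (w : Walk x y ℓ) → Clean L w →
                  h ∈ N → y ∈ edge h → z ∈ edge h → z ∈ W →
                  AllV (_≢ z) w → AllE (_≢ h) w →
                  Conn x z τ → suc ℓ + τ ≡ suc (dbl k) → ⊥
    finish-snoc {h = h} w cl h∈ y∈h z∈h z∈W z≢ h≢ =
      finish (snoc w h y∈h z∈h) (snocDistinct w h y∈h z∈h (Clean.distinct cl) z≢ h≢)
        (snocV w h y∈h z∈h (mapV proj₁ w (Clean.verts cl)) z∈W)
        (snocE w h y∈h z∈h (mapE proj₁ w (Clean.edges cl)) h∈)

    -- All bichromatic pairs are joined through the tree by the same number `τ` of hyperedges, so a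
    -- path with `r + 1` hyperedges and ends of different colours would close up to a cycle of
    -- length `2k + 1`. The condition `2 ≤ τ` leaves room to reserve two vertices while a path with
    -- `r` hyperedges grows.
    module Colouring {C : Set} (_≟_ : DecidableEquality C) (χ : Fin n → C) {τ r : ℕ} (2≤τ : 2 ≤ τ)
                     (r+τ : r + τ ≡ dbl k)
                     (bichromatic : ∀ {x y} → x ∈ W → y ∈ W → χ x ≢ χ y → Conn x y τ) where

      2+r≤2k : 2 + r ≤ dbl k
      2+r≤2k = ≤-trans (+-monoˡ-≤ r 2≤τ) (≤-reflexive (trans (+-comm τ r) r+τ))

      -- Otherwise a path with r edges from v that avoids x and x′ extends by
      -- x or by x′ to a bichromatic path, which the tree closes up.
      neighbours : ∀ {v x x′ h h′} → v ∈ W → x ∈ W → x′ ∈ W → h ∈ N → h′ ∈ N →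
                   v ∈ edge h → x ∈ edge h → v ∈ edge h′ → x′ ∈ edge h′ →
                   v ≢ x → v ≢ x′ → χ x ≡ χ x′
      neighbours {v} {x} {x′} v∈ x∈ x′∈ h∈ h′∈ v∈h x∈h v∈h′ x′∈h′ v≢x v≢x′
        with grow r (x ∷ x′ ∷ []) v∈ (v≢x ∷ v≢x′ ∷ []) 2+r≤2k
      ... | u , w , cl with χ u ≟ χ x | χ u ≟ χ x′
      ... | yes eq | yes eq′ = trans (sym eq) eq′
      ... | no ne  | _       = ⊥-elim (finish-snoc w cl h∈ v∈h x∈h x∈
          (mapV (λ { (_ , ≢x ∷ _) → ≢x }) w (Clean.verts cl))
          (mapE (λ { (_ , x∉ ∷ _) refl → x∉ x∈h }) w (Clean.edges cl))
          (bichromatic (proj₁ (headV w (Clean.verts cl))) x∈ ne) (cong suc r+τ))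
      ... | yes _  | no ne   = ⊥-elim (finish-snoc w cl h′∈ v∈h′ x′∈h′ x′∈
          (mapV (λ { (_ , _ ∷ ≢x′ ∷ _) → ≢x′ }) w (Clean.verts cl))
          (mapE (λ { (_ , _ ∷ x′∉ ∷ _) refl → x′∉ x′∈h′ }) w (Clean.edges cl))
          (bichromatic (proj₁ (headV w (Clean.verts cl))) x′∈ ne) (cong suc r+τ))

      -- `x` and `z` are neighbours of `y`, so `neighbours` gives them the same colour, two steps at
      -- a time.
      even-walk : ∀ m {x y} (w : Walk x y (dbl m)) → Distinct w → AllV (_∈ W) w → AllE (_∈ N) w →
                  χ x ≡ χ y
      even-walk zero stop _ _ _ = refl
      even-walk (suc m) (step {x} {y} h x∈h y∈h w₁@(step {y} {z} g y∈g z∈g w))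
                ((x≢y , _) , _ , (y≢ , _ , d)) (x∈ , y∈ , v∈) (h∈ , g∈ , e∈) =
        trans (neighbours y∈ x∈ (headV w v∈) h∈ g∈ y∈h x∈h y∈g z∈g (≢-sym x≢y) (headV w y≢))
              (even-walk m w d v∈ e∈)

      even-clean : ∀ m {x y L} (w : Walk x y (dbl m)) → Clean L w → χ x ≡ χ y
      even-clean m w cl = even-walk m w (Clean.distinct cl)
        (mapV proj₁ w (Clean.verts cl)) (mapE proj₁ w (Clean.edges cl))

      crossing : ∀ {x y} → x ∈ W → y ∈ W → χ x ≢ χ y →
                 ∃ λ h → h ∈ N × ∃₂ λ u v → u ∈ edge h × v ∈ edge h × u ∈ W × v ∈ W × χ u ≢ χ v
      crossing {x} x∈ y∈ x≢y =
        let h , h∈ , u , v , u∈h , v∈h , u∈ , v∈ , qu , ¬qv =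
              connect (λ z → χ z ≟ χ x) x∈ refl y∈ (x≢y ∘ sym)
        in h , h∈ , u , v , u∈h , v∈h , u∈ , v∈ , λ eq → ¬qv (trans (sym eq) qu)

      -- From one end `v` of a bichromatic pair on a hyperedge, an even path with `r` hyperedges
      -- leads to a vertex of the colour of `v`. Prolonged by the other end `u`, it is bichromatic
      -- with `r + 1` hyperedges.
      odd-absurd : ∀ m → r ≡ dbl m → ∀ {x y} → x ∈ W → y ∈ W → χ x ≢ χ y → ⊥
      odd-absurd m refl x∈ y∈ x≢y with crossing x∈ y∈ x≢y
      ... | h , h∈ , u , v , u∈h , v∈h , u∈ , v∈ , χu≢χv
        with grow (dbl m) (u ∷ []) v∈ ((χu≢χv ∘ sym ∘ cong χ) ∷ []) (≤-trans (n≤1+n _) 2+r≤2k)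
      ... | x , w , cl = finish-snoc w cl h∈ v∈h u∈h u∈
          (mapV (λ { (_ , ≢u ∷ _) → ≢u }) w (Clean.verts cl))
          (mapE (λ { (_ , u∉ ∷ _) refl → u∉ u∈h }) w (Clean.edges cl))
          (bichromatic (proj₁ (headV w (Clean.verts cl))) u∈
             λ eq → χu≢χv (trans (sym eq) (even-clean m w cl))) (cong suc r+τ)

    -- All tree paths from W pass the hyperedge g just below z, which lies t + 2
    -- levels above W; so t + 1 ≥ 1 steps lead from W to the two children of z on g.
    module SharedParent {t m : ℕ} (i≡ : i ≡ suc t + suc m) {z : Fin n} {g : Fin e}
                        (par≡ : ∀ {x} → x ∈ W → par (anc (suc t) x) ≡ z)
                        (link≡ : ∀ {x} → x ∈ W → link (anc (suc t) x) ≡ g) where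

      t+2≤k : suc (suc t) ≤ k
      t+2≤k = ≤-trans (s≤s (≤-trans (≤-reflexive (+-comm 1 t)) (+-monoʳ-≤ t (s≤s z≤n))))
                      (≤-trans (≤-reflexive (sym i≡)) i≤k)

      -- Two children of `z` on `g` are joined by `g` alone, whence `t + 1` steps on each side and
      -- one hyperedge. As `τ` is odd, `r` is odd too, and `odd-absurd` does not apply.
      open Colouring Finₚ._≟_ (anc (suc t)) {τ = dbl (suc t) + 1} (s≤s (s≤s z≤n))
        (m∸n+n≡m (≤-trans (+-monoʳ-≤ (dbl (suc t)) (s≤s z≤n))
           (≤-trans (≤-reflexive (+-comm (dbl (suc t)) 2)) (dbl-mono-≤ t+2≤k))))
        (λ x∈ y∈ χ≢ → conn-anc (suc t)
           (shared χ≢ (trans (par≡ x∈) (sym (par≡ y∈))) (trans (link≡ x∈) (sym (link≡ y∈)))))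

      χ : Fin n → Fin n
      χ = anc (suc t)

      -- The bichromatic hyperedge h leads from the W-path on to y, which together
      -- with the other end, moved by f, is on level i′: here i′ = i or i′ = i − 1.
      module Detour {h u v} (h∈ : h ∈ N) (u∈h : u ∈ edge h) (v∈h : v ∈ edge h)
                    (u∈ : u ∈ W) (v∈ : v ∈ W) (χu≢χv : χ u ≢ χ v)
                    {t′ i′ : ℕ} (i′≡ : i′ ≡ t′ + suc m) (i′<k : i′ < k)
                    (f : Fin n → Fin n) (f-anc : ∀ {x} → x ∈ W → anc t′ (f x) ≡ χ x)
                    {y : Fin n} (dy : dist y ≡ i′) (y-anc : ∀ {b} → b ∈ W → b ≡ y → χ b ≡ anc t′ y)
                    -- `b` is the end of `h` where the path enters and `o` the other one. The 2
                    -- counts `h` and one link of the tree.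
                    (assemble : ∀ {b o x s τ} → b ∈ edge h → o ∈ edge h → b ∈ W →
                       (w : Walk x b s) → Clean (o ∷ y ∷ []) w →
                       Conn (f x) y τ → 2 + s + τ ≡ suc (dbl k) → ⊥) where

        y° : Fin n
        y° = anc t′ y

        1+m≤i′ : suc m ≤ i′
        1+m≤i′ = ≤-trans (m≤n+m (suc m) t′) (≤-reflexive (sym i′≡))

        m<k : m < k
        m<k = ≤-trans 1+m≤i′ (<⇒≤ i′<k)

        t′<k : t′ < k
        t′<k = ≤-trans (≤-trans (≤-trans (≤-reflexive (+-comm 1 t′)) (+-monoʳ-≤ t′ (s≤s z≤n)))
                                (≤-reflexive (sym i′≡))) (<⇒≤ i′<k)

        dist-y° : dist y° ≡ suc m
        dist-y° = dist-anc t′ (trans dy i′≡) (≤-trans (≤-reflexive (sym i′≡)) (<⇒≤ i′<k))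

        dist-z : dist z ≡ m
        dist-z = trans (cong dist (sym (par≡ u∈)))
          (dist-par (dist-anc (suc t) (trans (level u∈) i≡) (≤-trans (≤-reflexive (sym i≡)) i≤k)) m<k)

        -- y lies below g as well, so the colour of the far end has to differ from y°.
        sibling : ∀ {b o} → b ∈ edge h → o ∈ edge h → b ∈ W → b ≢ o → χ b ≢ y° →
                  par y° ≡ z → link y° ≡ g → ⊥
        sibling {b} {o} b∈h o∈h b∈ b≢o χb≢ py≡ ly≡
          -- The tree contributes `2t′ + 1`, so the path needs `2(k - t′ - 1)` hyperedges. This
          -- number is even, and therefore the far end inherits the colour of `b`.
          with grow (dbl (k ∸ suc t′)) (o ∷ y ∷ []) b∈ (b≢o ∷ (χb≢ ∘ y-anc b∈) ∷ [])
                 (dbl-mono-≤ (≤-trans (s≤s (∸-monoʳ-≤ k (s≤s (z≤n {t′}))))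
                   (≤-reflexive (m+[n∸m]≡n (≤-trans (s≤s z≤n) t′<k)))))
        ... | x , w , cl =
          let x∈ = proj₁ (headV w (Clean.verts cl)) in
          assemble b∈h o∈h b∈ w cl
            (conn-anc t′ (shared
              (λ eq → χb≢ (trans (sym (even-clean (k ∸ suc t′) w cl)) (trans (sym (f-anc x∈)) eq)))
              (trans (cong par (f-anc x∈)) (trans (par≡ x∈) (sym py≡)))
              (trans (cong link (f-anc x∈)) (trans (link≡ x∈) (sym ly≡)))))
            (begin-equality
              2 + dbl q + (dbl t′ + 1)     ≡⟨ cong (2 + dbl q +_) (+-comm (dbl t′) 1) ⟩
              2 + dbl q + suc (dbl t′)     ≡⟨ +-suc (2 + dbl q) (dbl t′) ⟩
              suc (2 + dbl q + dbl t′)     ≡⟨ cong suc (dbl-+ (suc q) t′) ⟨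
              suc (dbl (suc q + t′))       ≡⟨ cong (suc ∘ dbl) (+-suc q t′) ⟨
              suc (dbl (q + suc t′))       ≡⟨ cong (suc ∘ dbl) (m∸n+n≡m t′<k) ⟩
              suc (dbl k)                  ∎)
          where
          open ≤-Reasoning
          q = k ∸ suc t′

        -- y leaves the tree paths from W elsewhere, at a distance not depending on
        -- the far end, so that only the length of the path matters.
        stranger : ∀ {τ} → 2 ≤ τ → τ ≤ dbl (suc m) →
                   (∀ {a} → par a ≡ z → link a ≡ g → Conn a y° τ) → u ≢ y → ⊥
        stranger {τ} 2≤τ τ≤ conn u≢y with
          grow (dbl k ∸ suc (dbl t′ + τ)) (v ∷ y ∷ []) u∈ ((χu≢χv ∘ cong χ) ∷ u≢y ∷ [])
            (≤-trans (+-monoʳ-≤ 2 (∸-monoʳ-≤ (dbl k) (≤-trans 2≤τ (≤-trans (m≤n+m τ (dbl t′)) (n≤1+n _)))))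
                     (≤-reflexive (m+[n∸m]≡n (dbl-mono-≤ (≤-trans (s≤s z≤n) t′<k)))))
        ... | x , w , cl =
          let x∈ = proj₁ (headV w (Clean.verts cl)) in
          assemble u∈h v∈h u∈ w cl
            (conn-anc t′ (conn (trans (cong par (f-anc x∈)) (par≡ x∈))
                               (trans (cong link (f-anc x∈)) (link≡ x∈))))
            (begin-equality
              2 + s + (dbl t′ + τ)       ≡⟨ cong suc (+-suc s (dbl t′ + τ)) ⟨
              suc (s + suc (dbl t′ + τ)) ≡⟨ cong suc (m∸n+n≡m fits) ⟩
              suc (dbl k)                ∎)
          where
          open ≤-Reasoning
          s = dbl k ∸ suc (dbl t′ + τ)
          -- The tree contributes at most `2i′` hyperedges, and `i′ < k` leaves room for the detour.
          fits : suc (dbl t′ + τ) ≤ dbl k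
          fits = begin
            suc (dbl t′ + τ)           ≤⟨ s≤s (+-monoʳ-≤ (dbl t′) τ≤) ⟩
            suc (dbl t′ + dbl (suc m)) ≡⟨ cong suc (dbl-+ t′ (suc m)) ⟨
            suc (dbl (t′ + suc m))     ≡⟨ cong (suc ∘ dbl) i′≡ ⟨
            suc (dbl i′)               ≤⟨ n≤1+n _ ⟩
            dbl (suc i′)               ≤⟨ dbl-mono-≤ i′<k ⟩
            dbl k                      ∎

        -- If `y°` hangs below `z` on `g`, one end of `h` has a colour other than `y°` and `sibling`
        -- applies. If it hangs below `z` on another hyperedge, the tree paths fork at `z`.
        -- Otherwise they meet above `z`, and the connection of `z` with `par y°` is the same for
        -- every far end.
        absurd : ⊥
        absurd with par y° Finₚ.≟ z | link y° Finₚ.≟ g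
        ... | yes py≡ | yes ly≡ with χ u Finₚ.≟ y°
        ...   | no χu≢  = sibling u∈h v∈h u∈ (χu≢χv ∘ cong χ) χu≢ py≡ ly≡
        ...   | yes χu≡ = sibling v∈h u∈h v∈ (χu≢χv ∘ sym ∘ cong χ)
                            (λ χv≡ → χu≢χv (trans χu≡ (sym χv≡))) py≡ ly≡
        absurd | yes py≡ | no ly≢ =
          stranger ≤-refl (s≤s (s≤s z≤n))
            (λ pa la → fork (λ a≡ → ly≢ (trans (cong link (sym a≡)) la)) (trans pa (sym py≡))
                            (λ l≡ → ly≢ (trans (sym l≡) la)))
            (λ u≡y → ly≢ (trans (cong link (sym (y-anc u∈ u≡y))) (link≡ u∈)))
        absurd | no py≢ | _ =
          let τ , τ≤ , c = conn-total m (<⇒≤ m<k) dist-z (dist-par dist-y° m<k) (py≢ ∘ sym)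
          in stranger (s≤s (s≤s z≤n)) (s≤s (s≤s τ≤))
               (λ pa la → up (λ p≡ → py≢ (trans (sym p≡) pa)) (subst (λ b → Conn b (par y°) τ) (sym pa) c))
               (λ u≡y → py≢ (trans (cong par (sym (y-anc u∈ u≡y))) (par≡ u∈)))

      -- Let `w` be the third vertex of a bichromatic hyperedge. On level `i` it would be a common
      -- neighbour of `u` and `v`. One level nearer the root, `w` itself becomes an end of the path
      -- and the other end moves to its parent. One level farther away, the path returns to level
      -- `i` by the link of `w`.
      absurd : ∀ {x y} → x ∈ W → y ∈ W → χ x ≢ χ y → ⊥
      absurd x∈ y∈ χx≢χy with crossing x∈ y∈ χx≢χy
      ... | h , h∈ , u , v , u∈h , v∈h , u∈ , v∈ , χu≢χv with third h u v
      ... | w , w∈h , w≢u , w≢v with <-cmp (dist w) i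
      ... | tri≈ _ dw _ = χu≢χv (neighbours (full h∈ w∈h dw) u∈ v∈ h∈ h∈ w∈h u∈h w∈h v∈h w≢u w≢v)
      ... | tri< dw<i _ _ = Detour.absurd h∈ u∈h v∈h u∈ v∈ χu≢χv i′≡ i′<k par (λ _ → refl) dw
              (λ b∈ b≡w → contradiction (trans (sym (level b∈)) (trans (cong dist b≡w) dw))
                 (λ i≡i′ → 1+n≢n (trans (sym i≡1+i′) i≡i′)))
              λ {b} {o} {x} b∈h o∈h b∈ p cl c len →
                let x∈  = proj₁ (headV p (Clean.verts cl))
                    dx  = trans (level x∈) i≡1+i′
                    h≢  = mapE (λ { (_ , o∉ ∷ _) refl → o∉ o∈h }) p (Clean.edges cl)
                    w≢  = mapV (λ { (_ , _ ∷ ≢w ∷ _) → ≢w }) p (Clean.verts cl)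
                    p₁  = snoc p h b∈h w∈h
                    off : ∀ {v} → v ∈ W → par x ≢ v
                    off = λ v∈ px≡v → 1+n≢n (trans (sym i≡1+i′) (trans (sym (level v∈))
                            (trans (cong dist (sym px≡v)) (dist-par dx i′<k))))
                in ascend i′ (<⇒≤ i′<k) (dist-par dx i′<k) dw
                     (step (link x) (par∈link dx i′<k) (∈link dx i′<k) p₁)
                     ( snocV p h b∈h w∈h (mapV (off ∘ proj₁) p (Clean.verts cl)) (conn-≢ c)
                     , snocE p h b∈h w∈h (mapE (λ (g∈ , _) → free g∈ _ _ dx i′<k) p (Clean.edges cl))
                                         (free h∈ _ _ dx i′<k)
                     , snocDistinct p h b∈h w∈h (Clean.distinct cl) w≢ h≢)
                     ( ≤-reflexive (sym (dist-par dx i′<k))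
                     , snocV p h b∈h w∈h
                         (mapV (λ (v∈ , _) → <⇒≤ (≤-reflexive (trans (sym i≡1+i′) (sym (level v∈))))) p (Clean.verts cl))
                         (≤-reflexive (sym dw)))
                     ( link-free dx i′<k
                     , snocE p h b∈h w∈h
                         (mapE (λ (g∈ , _) → FreeUpTo-mono (<⇒≤ i′<k) (free g∈)) p (Clean.edges cl))
                         (FreeUpTo-mono (<⇒≤ i′<k) (free h∈)))
                     c len
        where
        i′ = t + suc m
        i′≡ : i′ ≡ t + suc m
        i′≡ = refl
        i≡1+i′ : i ≡ suc i′
        i≡1+i′ = i≡
        i′<k : i′ < k
        i′<k = ≤-trans (≤-reflexive (sym i≡)) i≤k
        dw : dist w ≡ i′
        dw = ≤-antisym (s≤s⁻¹ (≤-trans dw<i (≤-reflexive i≡)))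
               (s≤s⁻¹ (≤-trans (≤-reflexive (trans (sym i≡) (sym (level u∈)))) (lipschitz (inA h∈) u∈h w∈h)))
      ... | tri> _ _ i<dw = Detour.absurd h∈ u∈h v∈h u∈ v∈ χu≢χv {suc t} i≡ i<k id (λ _ → refl)
              (dist-par dw i<k) (λ _ → cong χ)
              λ {b} {o} {x} b∈h o∈h b∈ p cl c len →
                let x∈  = proj₁ (headV p (Clean.verts cl))
                    h≢  = mapE (λ { (_ , o∉ ∷ _) refl → o∉ o∈h }) p (Clean.edges cl)
                    w≢  = mapV (λ (v∈ , _) v≡w → 1+n≢n (trans (sym dw) (trans (cong dist (sym v≡w)) (level v∈))))
                            p (Clean.verts cl)
                    p₁  = snoc p h b∈h w∈h
                in ascend i i≤k (level x∈) (dist-par dw i<k)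
                     (snoc p₁ (link w) (∈link dw i<k) (par∈link dw i<k))
                     (snocDistinct p₁ (link w) _ _ (snocDistinct p h b∈h w∈h (Clean.distinct cl) w≢ h≢)
                        (snocV p h b∈h w∈h (mapV (λ { (_ , _ ∷ ≢y ∷ _) → ≢y }) p (Clean.verts cl))
                           (λ w≡pw → 1+n≢n (trans (sym dw) (trans (cong dist w≡pw) (dist-par dw i<k)))))
                        (snocE p h b∈h w∈h
                           (mapE (λ (g∈ , _) → ≢-sym (free g∈ _ _ dw i<k)) p (Clean.edges cl))
                           (≢-sym (free h∈ _ _ dw i<k))))
                     (snocV p₁ (link w) _ _
                        (snocV p h b∈h w∈h (mapV (λ (v∈ , _) → ≤-reflexive (sym (level v∈))) p (Clean.verts cl))
                           (≤-trans (n≤1+n i) (≤-reflexive (sym dw))))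
                        (≤-reflexive (sym (dist-par dw i<k))))
                     (snocE p₁ (link w) _ _
                        (snocE p h b∈h w∈h
                           (mapE (λ (g∈ , _) → FreeUpTo-mono i≤k (free g∈)) p (Clean.edges cl))
                           (FreeUpTo-mono i≤k (free h∈)))
                        (link-free dw i<k))
                     c len
        where
        dw : dist w ≡ suc i
        dw = ≤-antisym (≤-trans (lipschitz (inA h∈) w∈h u∈h) (≤-reflexive (cong suc (level u∈)))) i<dw
        i<k : i < k
        i<k = ≤-trans i<dw (low h∈ w∈h)

    -- The deepest common ancestor.

    Separates : ℕ → Set
    Separates t = ∃₂ λ x y → x ∈ W × y ∈ W × anc t x ≢ anc t y

    separates? : Decidable Separates
    separates? t = any? λ x → any? λ y → (x ∈? W) ×-dec (y ∈? W) ×-dec ¬? (anc t x Finₚ.≟ anc t y)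

    -- The ancestors `t + 1` steps up coincide in the deepest common ancestor, and `anc t` sends `W`
    -- to children of it, at least two in number.
    module LastSeparation {t : ℕ} (t<i : t < i) {a b : Fin n} (a∈ : a ∈ W) (b∈ : b ∈ W)
                          (a≢b : anc t a ≢ anc t b) (¬sep : ¬ Separates (suc t)) where

      m : ℕ
      m = i ∸ suc t

      i≡ : i ≡ t + suc m
      i≡ = trans (sym (m+[n∸m]≡n t<i)) (sym (+-suc t m))

      t<k : t < k
      t<k = ≤-trans t<i i≤k

      par≡ : ∀ {x y} → x ∈ W → y ∈ W → par (anc t x) ≡ par (anc t y)
      par≡ {x} {y} x∈ y∈ = trans (par-anc t x) (trans
        (decidable-stable (anc (suc t) x Finₚ.≟ anc (suc t) y) λ ne → ¬sep (x , y , x∈ , y∈ , ne))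
        (sym (par-anc t y)))

      -- The variable `s` permits a case split on the module parameter `t`. For `t = 0` all of `W`
      -- lies on one link; by linearity a hyperedge of `N` with two vertices in `W` equals that
      -- link, but the hyperedges of `N` are free.
      shared-link : ∀ s → s ≡ t → (∀ {x y} → x ∈ W → y ∈ W → link (anc t x) ≡ link (anc t y)) → ⊥
      shared-link zero refl link≡
        with connect (λ z → z Finₚ.≟ a) a∈ refl b∈ (a≢b ∘ sym)
      ... | h , h∈ , u , v , u∈h , v∈h , u∈ , v∈ , u≡a , v≢a =
        free h∈ _ _ (trans (level u∈) i≡) m<k
          (meet-once (λ u≡v → v≢a (trans (sym u≡v) u≡a)) (∈link (trans (level u∈) i≡) m<k)
            (subst (λ g → v ∈ edge g) (link≡ v∈ u∈) (∈link (trans (level v∈) i≡) m<k)) u∈h v∈h)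
        where
        m<k : m < k
        m<k = ≤-trans (≤-reflexive (sym i≡)) i≤k
      shared-link (suc s) refl link≡ =
        SharedParent.absurd i≡ (λ x∈ → par≡ x∈ a∈) (λ x∈ → link≡ x∈ a∈) a∈ b∈ a≢b

      absurd : ⊥
      absurd with any? (λ x → any? (λ y →
                    (x ∈? W) ×-dec (y ∈? W) ×-dec ¬? (link (anc t x) Finₚ.≟ link (anc t y))))
      ... | no same = shared-link t refl λ {x} {y} x∈ y∈ →
        decidable-stable (link (anc t x) Finₚ.≟ link (anc t y)) λ ne → same (x , y , x∈ , y∈ , ne)
      -- Different links below the common parent fork there, so `τ = 2t + 2` and `r = 2(k - t - 1)`
      -- are even.
      ... | yes (x , y , x∈ , y∈ , ne) = Colouring.odd-absurd Finₚ._≟_ (link ∘ anc t)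
        {τ = dbl t + 2} {r = dbl (k ∸ suc t)} (m≤n+m 2 (dbl t))
        (trans (cong (dbl (k ∸ suc t) +_) (+-comm (dbl t) 2))
           (trans (sym (dbl-+ (k ∸ suc t) (suc t))) (cong dbl (m∸n+n≡m t<k))))
        (λ x∈ y∈ l≢ → conn-anc t (fork (l≢ ∘ cong link) (par≡ x∈ y∈) l≢))
        (k ∸ suc t) refl x∈ y∈ ne

    contradictory : ∀ {x y} → x ∈ W → y ∈ W → x ≢ y → ⊥
    contradictory {x} {y} x∈ y∈ x≢y =
      let t , t<i , (_ , _ , a∈ , b∈ , a≢b) , ¬sep =
            last-true separates? i (x , y , x∈ , y∈ , x≢y) λ (_ , _ , u∈ , v∈ , ne) →
              ne (trans (at-root u∈) (sym (at-root v∈)))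
      in LastSeparation.absurd t<i a∈ b∈ a≢b ¬sep
      where
      at-root : ∀ {x} → x ∈ W → anc i x ≡ root
      at-root x∈ = dist≡0 (dist-anc i (trans (level x∈) (sym (+-identityʳ i)))
                             (≤-trans (≤-reflexive (+-identityʳ i)) i≤k))

-- Counting the hyperedges at a level.

module LevelBound
  {n e : ℕ} (edge : Fin e → Subset n) (linear : Linear edge) (uniform : ∀ h → ∣ edge h ∣ ≡ 3)
  (A : Subset e) (k : ℕ) (T : Linear3Graph.SearchTree edge linear uniform A k)
  (acyclic : ¬ HasBergeCycle (suc (dbl k)) edge) where

  open Linear3Graph edge linear uniform
  open SearchTree T
  open Ascent T acyclic
  open LevelGraph edge linear uniform A k T acyclic

  -- By linearity each vertex of `L` shares at most one hyperedge of `S` with `v`; that one is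
  -- removed before the search goes on.
  avoid-list : ∀ {v} (S : Subset e) → (∀ {h} → h ∈ S → v ∈ edge h) →
               (L : List (Fin n)) → All (v ≢_) L → length L < ∣ S ∣ →
               ∃ λ h → h ∈ S × All (_∉ edge h) L
  avoid-list S v∈ []      _          lt = let h , h∈ = ∣∣>0⇒nonempty S lt in h , h∈ , []
  avoid-list S v∈ (x ∷ L) (v≢x ∷ v∉) lt with any? (λ h → (h ∈? S) ×-dec (x ∈? edge h))
  ... | no none =
    let h , h∈ , ∉h = avoid-list S v∈ L v∉ (<⇒≤ lt)
    in h , h∈ , (λ x∈h → none (h , h∈ , x∈h)) ∷ ∉h
  ... | yes (g , g∈ , x∈g) =
    let h , h∈ , ∉h = avoid-list (S - g) (v∈ ∘ p─q⊆p S ⁅ g ⁆) L v∉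
                        (s≤s⁻¹ (≤-trans lt (∣p∣≤1+∣p-x∣ S g)))
        h∈S = p─q⊆p S ⁅ g ⁆ h∈
    in h , h∈S ,
       (λ x∈h → x∈p-y⇒x≢y S g h∈ (meet-once v≢x (v∈ h∈S) x∈h (v∈ g∈) x∈g)) ∷ ∉h

  level? : ∀ i → Decidable (λ x → dist x ≡ i)
  level? i x = dist x ≟ i

  Level : ℕ → Subset n
  Level i = select (level? i)

  Link : Fin e → Set
  Link h = ∃ λ u → 0 < dist u × dist u ≤ k × link u ≡ h

  link? : Decidable Link
  link? h = any? λ u → (0 <? dist u) ×-dec (dist u ≤? k) ×-dec (link u Finₚ.≟ h)

  DoublyMeets : ℕ → Fin e → Set
  DoublyMeets i h = ∃₂ λ x y → x ≢ y × x ∈ edge h × y ∈ edge h × dist x ≡ i × dist y ≡ i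

  Dangling : ℕ → Fin e → Set
  Dangling i h = h ∈ A × ¬ Link h × (∀ x → x ∈ edge h → dist x ≤ k) × DoublyMeets i h

  dangling? : ∀ i → Decidable (Dangling i)
  dangling? i h =
    (h ∈? A) ×-dec ¬? (link? h)
    ×-dec (all? λ x → (x ∈? edge h) →-dec (dist x ≤? k))
    ×-dec any? λ x → any? λ y →
            ¬? (x Finₚ.≟ y) ×-dec (x ∈? edge h) ×-dec (y ∈? edge h) ×-dec (dist x ≟ i) ×-dec (dist y ≟ i)

  Danglings : ℕ → Subset e
  Danglings i = select (dangling? i)

  ¬Link⇒free : ∀ {h} → ¬ Link h → FreeUpTo k h
  ¬Link⇒free ¬link u j du j<k refl =
    ¬link (u , ≤-trans (s≤s z≤n) (≤-reflexive (sym du)) , ≤-trans (≤-reflexive du) j<k , refl)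

  -- Beyond this bound the traces on level `i` have a minimal dense set `W`. Minimality yields
  -- degrees of at least `2k` (`star-bound`) and connectedness, hence a `LevelSubgraph`, and
  -- `contradictory` refutes it by two vertices of one of its hyperedges.
  ∣Danglings∣≤ : ∀ {i} → i ≤ k → 0 < k → ∣ Danglings i ∣ ≤ (dbl k ∸ 1) * ∣ Level i ∣
  ∣Danglings∣≤ {i} i≤k 0<k = ≮⇒≥ λ dense →
    let W , minimal = minimalDense (Level i) (≤-trans dense (p⊆q⇒∣p∣≤∣q∣ {p = Danglings i} λ {h} h∈ →
          ∈-select⁺ (inner? (Level i)) {h} (h∈ , p∩q⊆q (edge h) (Level i))))
    in Subgraph.absurd minimal
    where
    open Density (λ h → edge h ∩ Level i) (Danglings i) (dbl k ∸ 1)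

    module Subgraph {W : Subset n} (minimal : MinimalDense W) where
      open Minimal minimal

      dangling : ∀ {h} → h ∈ inner W → Dangling i h
      dangling h∈ = ∈-select⁻ (dangling? i) (proj₁ (∈-select⁻ (inner? W) h∈))

      trace⊆ : ∀ {h x} → h ∈ inner W → x ∈ edge h → dist x ≡ i → x ∈ W
      trace⊆ h∈ x∈h dx =
        proj₂ (∈-select⁻ (inner? W) h∈) (x∈p∩q⁺ (x∈h , ∈-select⁺ (level? i) dx))

      star : Fin n → Subset e
      star v = touching W ⁅ v ⁆

      star-bound : ∀ {v} → v ∈ W → dbl k ∸ 1 < ∣ star v ∣
      star-bound {v} v∈ = subst (_< ∣ star v ∣)
        (trans (cong ((dbl k ∸ 1) *_) (∣⁅x⁆∣≡1 v)) (*-identityʳ _))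
        (touching-bound ⁅ v ⁆ (λ x∈ → subst (_∈ W) (sym (x∈⁅y⁆⇒x≡y v x∈)) v∈) (v , x∈⁅x⁆ v))

      star⁻ : ∀ {v h} → h ∈ star v → h ∈ inner W × v ∈ edge h ∩ Level i
      star⁻ {v} h∈ with ∈-select⁻ (touching? W ⁅ v ⁆) h∈
      ... | h∈N , x , x∈tr , x∈ = h∈N , subst (_∈ _) (x∈⁅y⁆⇒x≡y v x∈) x∈tr

      pair : ∀ {h} → h ∈ inner W → DoublyMeets i h
      pair h∈ = proj₂ (proj₂ (proj₂ (dangling h∈)))

      subgraph : LevelSubgraph i
      subgraph = record
        { i≤k     = i≤k
        ; W       = W
        ; N       = inner W
        ; level   = λ v∈ →
            let h , h∈ = ∣∣>0⇒nonempty (star _) (≤-trans (s≤s z≤n) (star-bound v∈))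
            in ∈-select⁻ (level? i) (proj₂ (x∈p∩q⁻ (edge h) (Level i) (proj₂ (star⁻ h∈))))
        ; inA     = λ h∈ → proj₁ (dangling h∈)
        ; free    = λ h∈ → ¬Link⇒free (proj₁ (proj₂ (dangling h∈)))
        ; low     = λ h∈ → proj₁ (proj₂ (proj₂ (dangling h∈))) _
        ; full    = trace⊆
        ; another = another
        ; avoid   = λ {v} v∈ L v∉ len →
            let h , h∈ , ∉h = avoid-list (star v)
                  (λ h∈ → proj₁ (x∈p∩q⁻ (edge _) (Level i) (proj₂ (star⁻ h∈)))) L v∉
                  (≤-trans (≤-trans len (suc-pred-≤ (dbl k))) (star-bound v∈))
                h∈N , v∈tr = star⁻ h∈
            in h , h∈N , proj₁ (x∈p∩q⁻ (edge h) (Level i) v∈tr) , ∉h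
        ; connect = λ Q? x∈ qx y∈ ¬qy →
            let h , h∈ , u , v , u∈ , v∈ , qu , ¬qv = connected Q? x∈ qx y∈ ¬qy
                tr = proj₂ (∈-select⁻ (inner? W) h∈)
            in h , h∈ , u , v , proj₁ (x∈p∩q⁻ (edge h) (Level i) u∈) ,
               proj₁ (x∈p∩q⁻ (edge h) (Level i) v∈) , tr u∈ , tr v∈ , qu , ¬qv
        }
        where
        suc-pred-≤ : ∀ m → m ≤ suc (m ∸ 1)
        suc-pred-≤ zero    = z≤n
        suc-pred-≤ (suc m) = ≤-refl
        another : ∀ {h} → h ∈ inner W → ∀ v → ∃ λ u → u ≢ v × u ∈ edge h × u ∈ W
        another h∈ v with pair h∈
        ... | x , y , x≢y , x∈ , y∈ , dx , dy with x Finₚ.≟ v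
        ...   | yes refl = y , ≢-sym x≢y , y∈ , trace⊆ h∈ y∈ dy
        ...   | no x≢v   = x , x≢v , x∈ , trace⊆ h∈ x∈ dx

      absurd : ⊥
      absurd =
        let h , h∈ = ∣∣>0⇒nonempty (inner W) (≤-trans (s≤s z≤n) (proj₁ minimal))
            x , y , x≢y , x∈ , y∈ , dx , dy = pair h∈
        in Within.contradictory subgraph (trace⊆ h∈ x∈ dx) (trace⊆ h∈ y∈ dy) x≢y

  links? : ∀ i → Decidable (λ h → ∃ λ y → dist y ≡ i × link y ≡ h)
  links? i h = any? λ y → (dist y ≟ i) ×-dec (link y Finₚ.≟ h)

  Links : ℕ → Subset e
  Links i = select (links? i)

  ∣Links∣≤ : ∀ i → ∣ Links i ∣ ≤ ∣ Level i ∣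
  ∣Links∣≤ i = ∣∣-injection (Links i) (Level i) (λ h h∈ → proj₁ (∈-select⁻ (links? i) h∈))
    (λ h h∈ → ∈-select⁺ (level? i) (proj₁ (proj₂ (∈-select⁻ (links? i) h∈))))
    (λ g g∈ h h∈ eq → trans (sym (proj₂ (proj₂ (∈-select⁻ (links? i) g∈))))
                        (trans (cong link eq) (proj₂ (proj₂ (∈-select⁻ (links? i) h∈)))))

  not-across : ∀ {h v w i} → h ∈ A → v ∈ edge h → w ∈ edge h →
               suc (dist v) ≡ i → dist w ≡ suc i → ⊥
  not-across h∈A v∈h w∈h dv dw = 1+n≰n (≤-trans (≤-reflexive (sym dw))
    (≤-trans (lipschitz h∈A w∈h v∈h) (≤-reflexive dv)))

  adjacent-levels : ∀ {h x v} → h ∈ A → x ∈ edge h → v ∈ edge h →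
                    suc (dist v) ≡ dist x ⊎ dist v ≡ dist x ⊎ dist v ≡ suc (dist x)
  adjacent-levels {h} {x} {v} h∈A x∈h v∈h with <-cmp (dist v) (dist x)
  ... | tri< lt _ _ = inj₁ (≤-antisym lt (lipschitz h∈A x∈h v∈h))
  ... | tri≈ _ eq _ = inj₂ (inj₁ eq)
  ... | tri> _ _ gt = inj₂ (inj₂ (≤-antisym (lipschitz h∈A v∈h x∈h) gt))

  -- No hyperedge reaches both level `i - 1` and level `i + 1`, so its three vertices occupy at most
  -- two levels and two of them share one.
  doublyMeets-near : ∀ {h x i} → h ∈ A → x ∈ edge h → dist x ≡ i →
                     DoublyMeets (i ∸ 1) h ⊎ DoublyMeets i h ⊎ DoublyMeets (suc i) h
  doublyMeets-near {h} {x} h∈A x∈h refl with third h x x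
  ... | y , y∈h , y≢x , _ with third h x y
  ... | z , z∈h , z≢x , z≢y with adjacent-levels h∈A x∈h y∈h | adjacent-levels h∈A x∈h z∈h
  ... | inj₂ (inj₁ dy) | _ = inj₂ (inj₁ (x , y , ≢-sym y≢x , x∈h , y∈h , refl , dy))
  ... | _ | inj₂ (inj₁ dz) = inj₂ (inj₁ (x , z , ≢-sym z≢x , x∈h , z∈h , refl , dz))
  ... | inj₁ dy | inj₁ dz =
    inj₁ (y , z , ≢-sym z≢y , y∈h , z∈h , cong (_∸ 1) dy , cong (_∸ 1) dz)
  ... | inj₂ (inj₂ dy) | inj₂ (inj₂ dz) = inj₂ (inj₂ (y , z , ≢-sym z≢y , y∈h , z∈h , dy , dz))
  ... | inj₁ dy        | inj₂ (inj₂ dz) = ⊥-elim (not-across h∈A y∈h z∈h dy dz)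
  ... | inj₂ (inj₂ dy) | inj₁ dz        = ⊥-elim (not-across h∈A z∈h y∈h dz dy)

  -- If `h` is the link of `u`, it contains `u` and `par u` on consecutive levels, and the Lipschitz
  -- property puts `x` on one of these. Otherwise `h` is dangling, since `i < k` keeps all its
  -- vertices within distance `k`.
  cover : ∀ {h x i} → i < k → h ∈ A → x ∈ edge h → dist x ≡ i →
          h ∈ Danglings (i ∸ 1) ∪ (Danglings i ∪ (Danglings (suc i) ∪ (Links i ∪ Links (suc i))))
  cover {h} {x} {i} i<k h∈A x∈h dx with link? h
  ... | no ¬link = x∈p∪q⁺ (Sum.map (dang _) (λ s → x∈p∪q⁺ (Sum.map (dang _) (λ p → x∈p∪q⁺ (inj₁ (dang _ p))) s))
                     (doublyMeets-near h∈A x∈h dx))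
    where
    dang : ∀ j → DoublyMeets j h → h ∈ Danglings j
    dang j meets = ∈-select⁺ (dangling? j) (h∈A , ¬link ,
      (λ y y∈h → ≤-trans (lipschitz h∈A y∈h x∈h) (≤-trans (≤-reflexive (cong suc dx)) i<k)) , meets)
  ... | yes (u , 0<du , du≤k , refl) =
    x∈p∪q⁺ (inj₂ (x∈p∪q⁺ (inj₂ (x∈p∪q⁺ (inj₂ (x∈p∪q⁺ links))))))
    where
    j = dist u ∸ 1
    du : dist u ≡ suc j
    du = sym (m+[n∸m]≡n 0<du)
    j<k : j < k
    j<k = ≤-trans (≤-reflexive (sym du)) du≤k
    i≤1+j : i ≤ suc j
    i≤1+j = ≤-trans (≤-reflexive (sym dx)) (≤-trans (lipschitz h∈A x∈h (par∈link du j<k))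
              (≤-reflexive (cong suc (dist-par du j<k))))
    1+j≤1+i : suc j ≤ suc i
    1+j≤1+i = ≤-trans (≤-reflexive (sym du)) (≤-trans (lipschitz h∈A (∈link du j<k) x∈h)
                (≤-reflexive (cong suc dx)))
    links : link u ∈ Links i ⊎ link u ∈ Links (suc i)
    links with m≤n⇒m<n∨m≡n i≤1+j
    ... | inj₂ i≡ = inj₁ (∈-select⁺ (links? i) (u , trans du (sym i≡) , refl))
    ... | inj₁ lt = inj₂ (∈-select⁺ (links? (suc i)) (u , trans du (≤-antisym 1+j≤1+i lt) , refl))

^-distribʳ-* : ∀ j a b → (a * b) ℕ.^ j ≡ a ℕ.^ j * b ℕ.^ j
^-distribʳ-* zero    a b = refl
^-distribʳ-* (suc j) a b =
  trans (cong (a * b *_) (^-distribʳ-* j a b)) (interchange a b (a ℕ.^ j) (b ℕ.^ j))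
  where
  interchange : ∀ a b x y → a * b * (x * y) ≡ a * x * (b * y)
  interchange = solve-∀

-- Breadth-first search.

module BreadthFirst
  {n e : ℕ} (edge : Fin e → Subset n) (linear : Linear edge) (uniform : ∀ h → ∣ edge h ∣ ≡ 3)
  (A : Subset e) (k : ℕ) (root : Fin n) (default : Fin e) where

  open Linear3Graph edge linear uniform

  Near : Subset n → Fin n → Set
  Near S x = x ∈ S ⊎ ∃ λ h → h ∈ A × x ∈ edge h × ∃ λ y → y ∈ edge h × y ∈ S

  near? : ∀ S → Decidable (Near S)
  near? S x = (x ∈? S) ⊎-dec any? λ h →
    (h ∈? A) ×-dec (x ∈? edge h) ×-dec any? λ y → (y ∈? edge h) ×-dec (y ∈? S)

  ball : ℕ → Subset n
  ball zero    = ⁅ root ⁆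
  ball (suc i) = select (near? (ball i))

  ball-mono : ∀ {i j x} → i ≤ j → x ∈ ball i → x ∈ ball j
  ball-mono {j = zero}      z≤n x∈ = x∈
  ball-mono {i} {suc j} i≤1+j x∈ with m≤n⇒m<n∨m≡n i≤1+j
  ... | inj₂ refl = x∈
  ... | inj₁ i<1+j = ∈-select⁺ (near? (ball j)) (inj₁ (ball-mono (s≤s⁻¹ i<1+j) x∈))

  -- The distance from the root, cut off at the first argument.
  depth : ℕ → Fin n → ℕ
  depth zero    x = 0
  depth (suc m) x with x ∈? ball m
  ... | yes _ = depth m x
  ... | no _  = suc m

  depth≤ : ∀ m x → depth m x ≤ m
  depth≤ zero    x = z≤n
  depth≤ (suc m) x with x ∈? ball m
  ... | yes _ = m≤n⇒m≤1+n (depth≤ m x)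
  ... | no _  = ≤-refl

  ball⇒depth : ∀ m {i x} → x ∈ ball i → depth m x ≤ i
  ball⇒depth zero    x∈ = z≤n
  ball⇒depth (suc m) {i} {x} x∈ with x ∈? ball m
  ... | yes _ = ball⇒depth m x∈
  ... | no x∉ = ≰⇒> λ i≤m → x∉ (ball-mono i≤m x∈)

  depth⇒ball : ∀ m {i x} → i < m → depth m x ≤ i → x ∈ ball i
  depth⇒ball (suc m) {i} {x} i<1+m d≤ with x ∈? ball m | m≤n⇒m<n∨m≡n (s≤s⁻¹ i<1+m)
  ... | yes _  | inj₁ i<m = depth⇒ball m i<m d≤
  ... | yes x∈ | inj₂ refl = x∈
  ... | no _   | _         = contradiction d≤ (<⇒≱ i<1+m)

  -- Cutting off at `k + 1` keeps the distances up to `k` exact and collects everything else,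
  -- unreachable vertices included, on level `k + 1`.
  dist : Fin n → ℕ
  dist = depth (suc k)

  lipschitz : ∀ {h x y} → h ∈ A → x ∈ edge h → y ∈ edge h → dist x ≤ suc (dist y)
  lipschitz {h} {x} {y} h∈A x∈h y∈h with m≤n⇒m<n∨m≡n (depth≤ (suc k) y)
  ... | inj₁ dy<  = ball⇒depth (suc k) (∈-select⁺ (near? (ball (dist y)))
                      (inj₂ (h , h∈A , x∈h , y , y∈h , depth⇒ball (suc k) dy< ≤-refl)))
  ... | inj₂ dy≡  = ≤-trans (depth≤ (suc k) x) (≤-trans (≤-reflexive (sym dy≡)) (n≤1+n _))

  Parent : Fin n → Set
  Parent x = ∃ λ h → h ∈ A × x ∈ edge h × ∃ λ y → y ∈ edge h × dist x ≡ suc (dist y)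

  parent? : Decidable Parent
  parent? x = any? λ h →
    (h ∈? A) ×-dec (x ∈? edge h) ×-dec any? λ y → (y ∈? edge h) ×-dec (dist x ≟ suc (dist y))

  parent : ∀ {x i} → dist x ≡ suc i → i < k → Parent x
  parent {x} {i} dx i<k with
    ∈-select⁻ (near? (ball i)) (depth⇒ball (suc k) {suc i} (s≤s i<k) (≤-reflexive dx))
  ... | inj₁ x∈ = contradiction (≤-trans (≤-reflexive (sym dx)) (ball⇒depth (suc k) x∈)) 1+n≰n
  ... | inj₂ (h , h∈A , x∈h , y , y∈h , y∈) = h , h∈A , x∈h , y , y∈h ,
    ≤-antisym (lipschitz h∈A x∈h y∈h)
              (≤-trans (s≤s (ball⇒depth (suc k) y∈)) (≤-reflexive (sym dx)))

  choose : ∀ {x} → Dec (Parent x) → Fin n × Fin e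
  choose (yes (h , _ , _ , y , _)) = y , h
  -- By `parent` this never happens on the levels 1 to `k`, so the default values do not matter.
  choose (no _)                    = root , default

  choose-spec : ∀ {x} (d : Dec (Parent x)) → Parent x →
                proj₂ (choose d) ∈ A × x ∈ edge (proj₂ (choose d)) ×
                proj₁ (choose d) ∈ edge (proj₂ (choose d)) × dist x ≡ suc (dist (proj₁ (choose d)))
  choose-spec (yes (_ , h∈A , x∈h , _ , y∈h , dx)) _ = h∈A , x∈h , y∈h , dx
  choose-spec (no ¬p)                              p = contradiction p ¬p

  tree : SearchTree A k
  tree = record
    { root      = root
    ; dist      = dist
    ; par       = λ x → proj₁ (choose (parent? x))
    ; link      = λ x → proj₂ (choose (parent? x))
    ; lipschitz = lipschitz
    ; dist-root = n≤0⇒n≡0 (ball⇒depth (suc k) (x∈⁅x⁆ root))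
    ; dist≡0    = λ dx → x∈⁅y⁆⇒x≡y root (depth⇒ball (suc k) (s≤s z≤n) (≤-reflexive dx))
    ; link∈A    = λ dx i<k → proj₁ (spec dx i<k)
    ; ∈link     = λ dx i<k → proj₁ (proj₂ (spec dx i<k))
    ; par∈link  = λ dx i<k → proj₁ (proj₂ (proj₂ (spec dx i<k)))
    ; dist-par  = λ dx i<k → suc-injective (trans (sym (proj₂ (proj₂ (proj₂ (spec dx i<k))))) dx)
    }
    where
    spec : ∀ {x i} (dx : dist x ≡ suc i) (i<k : i < k) → _
    spec {x} dx i<k = choose-spec (parent? x) (parent dx i<k)

-- Growth of the levels.

module Expansion
  {n e : ℕ} (edge : Fin e → Subset n) (linear : Linear edge) (uniform : ∀ h → ∣ edge h ∣ ≡ 3)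
  (k : ℕ) (0<k : 0 < k) (acyclic : ¬ HasBergeCycle (suc (dbl k)) edge)
  (c : ℕ) {W : Subset n} (minimal : Density.MinimalDense edge ⊤ c W)
  (T : Linear3Graph.SearchTree edge linear uniform (Density.inner edge ⊤ c W) k)
  (root∈W : Linear3Graph.SearchTree.root T ∈ W) where

  open Density edge ⊤ c
  open Minimal minimal
  open Linear3Graph.SearchTree T
  open LevelBound edge linear uniform (inner W) k T acyclic

  size : ℕ → ℕ
  size i = ∣ Level i ∣

  Level⊆W : ∀ {i} → i ≤ k → Level i ⊆ W
  Level⊆W {zero}  _   x∈ = subst (_∈ W) (sym (dist≡0 (∈-select⁻ (level? 0) x∈))) root∈W
  Level⊆W {suc i} i<k x∈ = let dx = ∈-select⁻ (level? (suc i)) x∈ in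
    proj₂ (∈-select⁻ (inner? W) (link∈A dx i<k)) (∈link dx i<k)

  size-0 : 1 ≤ size 0
  size-0 = ≤-trans (≤-reflexive (sym (∣⁅x⁆∣≡1 root))) (p⊆q⇒∣p∣≤∣q∣ {p = ⁅ root ⁆} λ x∈ →
    ∈-select⁺ (level? 0) (trans (cong dist (x∈⁅y⁆⇒x≡y root x∈)) dist-root))

  touching-level : ∀ {i} → i ≤ k → c * size i ≤ ∣ touching W (Level i) ∣
  touching-level {i} i≤k with nonempty? (Level i)
  ... | yes ne = <⇒≤ (touching-bound (Level i) (Level⊆W i≤k) ne)
  ... | no ¬ne = ≤-trans (≤-reflexive (trans (cong (λ S → c * ∣ S ∣) (Empty-unique ¬ne))
                   (trans (cong (c *_) (∣⊥∣≡0 n)) (*-zeroʳ c)))) z≤n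

  b : ℕ
  b = dbl k ∸ 1

  -- By minimality at least `c * size i` hyperedges inside `W` meet level `i`; `cover` sorts them
  -- into five families, each bounded in terms of its own level.
  growth : ∀ {i} → i < k →
           c * size i ≤ b * size (i ∸ 1) + (b * size i + (b * size (suc i) + (size i + size (suc i))))
  growth {i} i<k = begin
    c * size i              ≤⟨ touching-level (<⇒≤ i<k) ⟩
    ∣ touching W (Level i) ∣  ≤⟨ ⊆∪⇒∣∣≤ D₀ (D₁ ∪ (D₂ ∪ (L₁ ∪ L₂))) covered ⟩
    ∣ D₀ ∣ + ∣ D₁ ∪ (D₂ ∪ (L₁ ∪ L₂)) ∣
      ≤⟨ +-mono-≤ (∣Danglings∣≤ (≤-trans (m∸n≤m i 1) (<⇒≤ i<k)) 0<k)
           (≤-trans (∣p∪q∣≤∣p∣+∣q∣ D₁ _) (+-mono-≤ (∣Danglings∣≤ (<⇒≤ i<k) 0<k)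
             (≤-trans (∣p∪q∣≤∣p∣+∣q∣ D₂ _) (+-mono-≤ (∣Danglings∣≤ i<k 0<k)
               (≤-trans (∣p∪q∣≤∣p∣+∣q∣ L₁ L₂) (+-mono-≤ (∣Links∣≤ i) (∣Links∣≤ (suc i)))))))) ⟩
    _ ∎
    where
    open ≤-Reasoning
    D₀ = Danglings (i ∸ 1)
    D₁ = Danglings i
    D₂ = Danglings (suc i)
    L₁ = Links i
    L₂ = Links (suc i)
    covered : touching W (Level i) ⊆ D₀ ∪ (D₁ ∪ (D₂ ∪ (L₁ ∪ L₂)))
    covered h∈ with ∈-select⁻ (touching? W (Level i)) h∈
    ... | h∈A , x , x∈h , x∈ = cover i<k h∈A x∈h (∈-select⁻ (level? i) x∈)

  K : ℕ
  K = dbl k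

  module Large (K+9k≤1+c : K + 9 * k ≤ suc c) where

    -- Starting from `suc c` matches the estimate `e ≤ suc c * n` in `edges-bound`, so that rounding
    -- costs nothing.
    a : ℕ
    a = suc c ∸ 9 * k

    9k≤1+c : 9 * k ≤ suc c
    9k≤1+c = ≤-trans (m≤n+m (9 * k) K) K+9k≤1+c

    K≤a : K ≤ a
    K≤a = m+n≤o⇒m≤o∸n K K+9k≤1+c

    0<K : 0 < K
    0<K = ≤-trans (s≤s z≤n) (dbl-mono-≤ 0<k)

    1+2K≤9k : suc (K + K) ≤ 9 * k
    1+2K≤9k = begin
      suc (K + K)             ≡⟨ cong (λ m → suc (m + m)) (dbl≡2* k) ⟩
      suc (2 * k + 2 * k)     ≤⟨ +-monoˡ-≤ (2 * k + 2 * k) 0<k ⟩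
      k + (2 * k + 2 * k)     ≤⟨ m≤m+n _ (4 * k) ⟩
      k + (2 * k + 2 * k) + 4 * k ≡⟨ sum-of-parts k ⟩
      9 * k                   ∎
      where
      open ≤-Reasoning
      sum-of-parts : ∀ k → k + (2 * k + 2 * k) + 4 * k ≡ 9 * k
      sum-of-parts = solve-∀

    -- The extra `s₁` in `suc c * s₁` completes `b` to `b + 1 = K`, which gives
    -- `suc c * s₁ ≤ K * s₂ + 2 * K * s₁`; the term `2 * K = 4 * k` is absorbed by `9 * k`.
    expand : ∀ {i} → i < k → size (i ∸ 1) ≤ size i → a * size i ≤ K * size (suc i)
    expand {i} i<k mono = +-cancelʳ-≤ (9 * k * s₁) _ _ (begin
      a * s₁ + 9 * k * s₁                 ≡⟨ *-distribʳ-+ s₁ a (9 * k) ⟨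
      (a + 9 * k) * s₁                    ≡⟨ cong (_* s₁) (m∸n+n≡m 9k≤1+c) ⟩
      s₁ + c * s₁                         ≤⟨ +-monoʳ-≤ s₁ (growth i<k) ⟩
      s₁ + (b * s₀ + (b * s₁ + (b * s₂ + (s₁ + s₂))))
        ≤⟨ +-monoʳ-≤ s₁ (+-monoˡ-≤ _ (*-monoʳ-≤ b mono)) ⟩
      s₁ + (b * s₁ + (b * s₁ + (b * s₂ + (s₁ + s₂))))
        ≡⟨ regroup b s₁ s₂ ⟩
      suc b * s₂ + (suc b + suc b) * s₁   ≡⟨ cong (λ m → m * s₂ + (m + m) * s₁) (m+[n∸m]≡n 0<K) ⟩
      K * s₂ + (K + K) * s₁               ≤⟨ +-monoʳ-≤ (K * s₂) (*-monoˡ-≤ s₁ (≤-trans (n≤1+n _) 1+2K≤9k)) ⟩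
      K * s₂ + 9 * k * s₁                 ∎)
      where
      open ≤-Reasoning
      s₀ = size (i ∸ 1)
      s₁ = size i
      s₂ = size (suc i)
      regroup : ∀ b s₁ s₂ → s₁ + (b * s₁ + (b * s₁ + (b * s₂ + (s₁ + s₂)))) ≡
                            suc b * s₂ + (suc b + suc b) * s₁
      regroup = solve-∀

    -- Growth on one level, with `K ≤ a`, supplies the hypothesis of `expand` on the next.
    size-mono : ∀ i → i ≤ k → size (i ∸ 1) ≤ size i
    size-mono zero    _   = ≤-refl
    size-mono (suc i) i<k = *-cancelˡ-≤ K {{>-nonZero 0<K}}
      (≤-trans (*-monoˡ-≤ (size i) K≤a) (expand i<k (size-mono i (<⇒≤ i<k))))

    power : ∀ i → i ≤ k → a ℕ.^ i ≤ K ℕ.^ i * size i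
    power zero    _   = ≤-trans size-0 (≤-reflexive (sym (*-identityˡ _)))
    power (suc i) i<k = begin
      a * a ℕ.^ i                  ≤⟨ *-monoʳ-≤ a (power i (<⇒≤ i<k)) ⟩
      a * (K ℕ.^ i * size i)       ≡⟨ swap a (K ℕ.^ i) (size i) ⟩
      K ℕ.^ i * (a * size i)       ≤⟨ *-monoʳ-≤ (K ℕ.^ i) (expand i<k (size-mono i (<⇒≤ i<k))) ⟩
      K ℕ.^ i * (K * size (suc i)) ≡⟨ assoc (K ℕ.^ i) K (size (suc i)) ⟩
      K * K ℕ.^ i * size (suc i)   ∎
      where
      open ≤-Reasoning
      swap : ∀ x y z → x * (y * z) ≡ y * (x * z)
      swap = solve-∀
      assoc : ∀ x y z → x * (y * z) ≡ y * x * z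
      assoc = solve-∀

    a^k≤K^k*n : a ℕ.^ k ≤ K ℕ.^ k * n
    a^k≤K^k*n = ≤-trans (power k ≤-refl) (*-monoʳ-≤ (K ℕ.^ k) (∣p∣≤n (Level k)))

-- From expansion to the number of hyperedges.

module _
  {n e : ℕ} (edge : Fin e → Subset n) (linear : Linear edge) (uniform : ∀ h → ∣ edge h ∣ ≡ 3)
  (k : ℕ) (0<k : 0 < k) (acyclic : ¬ HasBergeCycle (suc (dbl k)) edge) where

  high-degree : ∀ c → c * n < e → dbl k + 9 * k ≤ suc c → (suc c ∸ 9 * k) ℕ.^ k ≤ dbl k ℕ.^ k * n
  high-degree c c*n<e large =
    let W , minimal = minimalDense ⊤ dense-⊤
        h , h∈ = ∣∣>0⇒nonempty (inner W) (≤-trans (s≤s z≤n) (proj₁ minimal))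
        x , x∈ = ∣∣>0⇒nonempty (edge h) (≤-trans (s≤s z≤n) (≤-reflexive (sym (uniform h))))
        -- Any vertex of a hyperedge inside `W` can be the root; `h` also serves as the default
        -- link.
        open BreadthFirst edge linear uniform (inner W) k x h
    in Expansion.Large.a^k≤K^k*n edge linear uniform k 0<k acyclic c minimal tree
         (proj₂ (∈-select⁻ (inner? W) h∈) x∈) large
    where
    open Density edge ⊤ c
    dense-⊤ : Dense ⊤
    dense-⊤ = ≤-trans
      (≤-trans (≤-reflexive (cong (λ m → suc (c * m)) (∣⊤∣≡n n))) c*n<e)
      (≤-trans (≤-reflexive (sym (∣⊤∣≡n e)))
         (p⊆q⇒∣p∣≤∣q∣ {p = ⊤} {q = inner ⊤} λ _ → ∈-select⁺ (inner? ⊤) (∈⊤ , λ _ → ∈⊤)))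

  edges-bound : 1 ≤ n → (e ∸ 9 * k * n) ℕ.^ k ≤ (2 * k) ℕ.^ k * n ℕ.^ (k + 1)
  edges-bound 1≤n = subst (λ K → (e ∸ 9 * k * n) ℕ.^ k ≤ K ℕ.^ k * n ℕ.^ (k + 1)) (dbl≡2* k) bound
    where
    open ≤-Reasoning
    instance
      n≢0 : NonZero n
      n≢0 = >-nonZero 1≤n
    k-th-powers : ∀ {a} → e ∸ 9 * k * n ≤ a * n → a ℕ.^ k ≤ dbl k ℕ.^ k * n →
                  (e ∸ 9 * k * n) ℕ.^ k ≤ dbl k ℕ.^ k * n ℕ.^ (k + 1)
    k-th-powers {a} le pow = begin
      (e ∸ 9 * k * n) ℕ.^ k              ≤⟨ ^-monoˡ-≤ k le ⟩
      (a * n) ℕ.^ k                      ≡⟨ ^-distribʳ-* k a n ⟩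
      a ℕ.^ k * n ℕ.^ k                  ≤⟨ *-monoˡ-≤ (n ℕ.^ k) pow ⟩
      dbl k ℕ.^ k * n * n ℕ.^ k          ≡⟨ *-assoc (dbl k ℕ.^ k) n (n ℕ.^ k) ⟩
      dbl k ℕ.^ k * n ℕ.^ suc k          ≡⟨ cong (λ j → dbl k ℕ.^ k * n ℕ.^ j) (+-comm 1 k) ⟩
      dbl k ℕ.^ k * n ℕ.^ (k + 1)        ∎
    -- For `e > 0` this is the largest `c` with `c * n < e`.
    c = (e ∸ 1) / n
    c*n<e : 0 < e → c * n < e
    c*n<e 0<e = ≤-trans (s≤s (m/n*n≤m (e ∸ 1) n)) (≤-reflexive (m+[n∸m]≡n 0<e))
    e≤[1+c]*n : e ≤ suc c * n
    e≤[1+c]*n = begin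
      e                             ≤⟨ m≤n+m∸n e 1 ⟩
      suc (e ∸ 1)                   ≡⟨ cong suc (m≡m%n+[m/n]*n (e ∸ 1) n) ⟩
      suc ((e ∸ 1) % n + c * n)     ≤⟨ +-monoˡ-≤ (c * n) (m%n<n (e ∸ 1) n) ⟩
      suc c * n                     ∎
    le : e ∸ 9 * k * n ≤ (suc c ∸ 9 * k) * n
    le = ≤-trans (∸-monoˡ-≤ (9 * k * n) e≤[1+c]*n) (≤-reflexive (sym (*-distribʳ-∸ n (suc c) (9 * k))))
    bound : (e ∸ 9 * k * n) ℕ.^ k ≤ dbl k ℕ.^ k * n ℕ.^ (k + 1)
    bound with 0 <? e | dbl k + 9 * k ≤? suc c
    ... | yes 0<e | yes large = k-th-powers le (high-degree c (c*n<e 0<e) large)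
    ... | yes _   | no ¬large = k-th-powers
      (≤-trans le (*-monoˡ-≤ n (≤-trans (∸-monoˡ-≤ (9 * k) (<⇒≤ (≰⇒> ¬large)))
         (≤-reflexive (m+n∸n≡m (dbl k) (9 * k))))))
      (m≤m*n (dbl k ℕ.^ k) n)
    ... | no e≡0  | _         = k-th-powers {0}
      (≤-trans (m∸n≤m e (9 * k * n)) (≮⇒≥ e≡0))
      (≤-trans (≤-reflexive (trans (cong (0 ℕ.^_) (sym (m+[n∸m]≡n 0<k))) refl)) z≤n)

-- Passage to rational bounds.

fromℕᵘ : ℕ → ℚᵘ.ℚᵘ
fromℕᵘ m = ℚᵘ.mkℚᵘ (ℤ.+ m) 0

toℚᵘ-fromℕ : ∀ m → ℚ.toℚᵘ (fromℕ m) ℚᵘ.≃ fromℕᵘ m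
toℚᵘ-fromℕ m = ℚₚ.toℚᵘ-fromℚᵘ (fromℕᵘ m)

fromℕ-mono-≤ : ∀ {a b} → a ≤ b → fromℕ a ℚ.≤ fromℕ b
fromℕ-mono-≤ {a} {b} a≤b = ℚₚ.toℚᵘ-cancel-≤ (begin
  ℚ.toℚᵘ (fromℕ a) ≃⟨ toℚᵘ-fromℕ a ⟩
  fromℕᵘ a         ≤⟨ ℚᵘ.*≤* (ℤₚ.*-monoʳ-≤-nonNeg (ℤ.+ 1) (ℤ.+≤+ a≤b)) ⟩
  fromℕᵘ b         ≃⟨ toℚᵘ-fromℕ b ⟨
  ℚ.toℚᵘ (fromℕ b) ∎)
  where open ℚᵘₚ.≤-Reasoning

fromℕ-+ : ∀ a b → fromℕ (a + b) ≡ fromℕ a ℚ.+ fromℕ b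
fromℕ-+ a b = ℚₚ.toℚᵘ-injective (begin-equality
  ℚ.toℚᵘ (fromℕ (a + b))                        ≃⟨ toℚᵘ-fromℕ (a + b) ⟩
  fromℕᵘ (a + b)                                ≃⟨ ℚᵘ.*≡* (cong (ℤ._* (ℤ.+ 1)) (cong₂ ℤ._+_ (ℤₚ.*-identityʳ (ℤ.+ a)) (ℤₚ.*-identityʳ (ℤ.+ b)))) ⟨
  fromℕᵘ a ℚᵘ.+ fromℕᵘ b                        ≃⟨ ℚᵘₚ.+-cong (toℚᵘ-fromℕ a) (toℚᵘ-fromℕ b) ⟨
  ℚ.toℚᵘ (fromℕ a) ℚᵘ.+ ℚ.toℚᵘ (fromℕ b)        ≃⟨ ℚₚ.toℚᵘ-homo-+ (fromℕ a) (fromℕ b) ⟨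
  ℚ.toℚᵘ (fromℕ a ℚ.+ fromℕ b)                  ∎)
  where open ℚᵘₚ.≤-Reasoning

fromℕ-* : ∀ a b → fromℕ (a * b) ≡ fromℕ a ℚ.* fromℕ b
fromℕ-* a b = ℚₚ.toℚᵘ-injective (begin-equality
  ℚ.toℚᵘ (fromℕ (a * b))                        ≃⟨ toℚᵘ-fromℕ (a * b) ⟩
  fromℕᵘ (a * b)                                ≃⟨ ℚᵘ.*≡* (cong (ℤ._* (ℤ.+ 1)) (ℤₚ.pos-* a b)) ⟩
  fromℕᵘ a ℚᵘ.* fromℕᵘ b                        ≃⟨ ℚᵘₚ.*-cong (toℚᵘ-fromℕ a) (toℚᵘ-fromℕ b) ⟨
  ℚ.toℚᵘ (fromℕ a) ℚᵘ.* ℚ.toℚᵘ (fromℕ b)        ≃⟨ ℚₚ.toℚᵘ-homo-* (fromℕ a) (fromℕ b) ⟨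
  ℚ.toℚᵘ (fromℕ a ℚ.* fromℕ b)                  ∎)
  where open ℚᵘₚ.≤-Reasoning

fromℕ-^ : ∀ a j → fromℕ (a ℕ.^ j) ≡ fromℕ a ^ j
fromℕ-^ a zero    = refl
fromℕ-^ a (suc j) = trans (fromℕ-* a (a ℕ.^ j)) (cong (fromℕ a ℚ.*_) (fromℕ-^ a j))

0≤fromℕ : ∀ m → ℚ.0ℚ ℚ.≤ fromℕ m
0≤fromℕ m = fromℕ-mono-≤ {0} {m} z≤n

^-positive : ∀ {x} j → ℚ.0ℚ ℚ.< x → ℚ.0ℚ ℚ.< x ^ j
^-positive         zero    0<x = ℚₚ.positive⁻¹ ℚ.1ℚ
^-positive {x} (suc j) 0<x =
  subst (ℚ._< x ℚ.* x ^ j) (ℚₚ.*-zeroʳ x) (ℚₚ.*-monoʳ-<-pos x {{ℚ.positive 0<x}} (^-positive j 0<x))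

^-mono-≤-nonNeg : ∀ {x y} j → ℚ.0ℚ ℚ.≤ x → x ℚ.< y → x ^ j ℚ.≤ y ^ j
^-mono-≤-nonNeg         zero    0≤x x<y = ℚₚ.≤-refl
^-mono-≤-nonNeg {x} {y} (suc j) 0≤x x<y = ℚₚ.≤-trans
  (ℚₚ.*-monoˡ-≤-nonNeg x {{ℚ.nonNegative 0≤x}} (^-mono-≤-nonNeg j 0≤x x<y))
  (ℚₚ.*-monoʳ-≤-nonNeg (y ^ j) {{ℚ.nonNegative (ℚₚ.<⇒≤ (^-positive j (ℚₚ.≤-<-trans 0≤x x<y)))}} (ℚₚ.<⇒≤ x<y))

^-mono-<-nonNeg : ∀ {x y} j → ℚ.0ℚ ℚ.≤ x → x ℚ.< y → x ^ suc j ℚ.< y ^ suc j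
^-mono-<-nonNeg {x} {y} j 0≤x x<y = ℚₚ.≤-<-trans
  (ℚₚ.*-monoˡ-≤-nonNeg x {{ℚ.nonNegative 0≤x}} (^-mono-≤-nonNeg j 0≤x x<y))
  (ℚₚ.*-monoˡ-<-pos (y ^ j) {{ℚ.positive (^-positive j (ℚₚ.≤-<-trans 0≤x x<y))}} x<y)

-- The `k`-th power turns the bound into one on natural numbers. Truncated subtraction is harmless,
-- since for `e ≤ 9 * k * n` the bound holds anyway.
turan : (k n : ℕ) → 2 ≤ k → 1 ≤ n → ∀ e → Attains n (1 + 2 * k) e →
        (e ∸ 9 * k * n) ℕ.^ k ≤ (2 * k) ℕ.^ k * n ℕ.^ (k + 1)
turan k n 2≤k 1≤n e (edge , hyp , linear , ¬cycle) =
  edges-bound edge linear (Is3Hypergraph.uniform hyp) k (≤-trans (s≤s z≤n) 2≤k)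
    (subst (λ m → ¬ HasBergeCycle (suc m) edge) (sym (dbl≡2* k)) ¬cycle) 1≤n

theorem3 : (k n : ℕ) → 2 ≤ k → 1 ≤ n →
    (q : ℚ.ℚ) → UpperBound[ n ^1+1/ k ] q →
    fromℕ (ex n (1 + 2 * k)) ℚ.≤ fromℕ (2 * k) ℚ.* q ℚ.+ fromℕ (9 * k * n)
theorem3 k@(suc j) n 2≤k 1≤n q (0≤q , n^k+1≤q^k) = begin
  fromℕ e                               ≤⟨ fromℕ-mono-≤ {e} {d + 9 * k * n} (≤-trans (m≤n+m∸n e (9 * k * n)) (≤-reflexive (+-comm (9 * k * n) d))) ⟩
  fromℕ (d + 9 * k * n)                 ≡⟨ fromℕ-+ d (9 * k * n) ⟩
  fromℕ d ℚ.+ fromℕ (9 * k * n)         ≤⟨ ℚₚ.+-monoˡ-≤ (fromℕ (9 * k * n)) (ℚₚ.≮⇒≥ d≮) ⟩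
  fromℕ (2 * k) ℚ.* q ℚ.+ fromℕ (9 * k * n) ∎
  where
  open ℚₚ.≤-Reasoning
  e = ex n (1 + 2 * k)
  d = e ∸ 9 * k * n
  instance
    2k-nonNeg : ℚ.NonNegative (fromℕ (2 * k))
    2k-nonNeg = ℚ.nonNegative (0≤fromℕ (2 * k))
    [2k]^k-nonNeg : ℚ.NonNegative (fromℕ ((2 * k) ℕ.^ k))
    [2k]^k-nonNeg = ℚ.nonNegative (0≤fromℕ ((2 * k) ℕ.^ k))
  0≤2kq : ℚ.0ℚ ℚ.≤ fromℕ (2 * k) ℚ.* q
  0≤2kq = subst (ℚ._≤ fromℕ (2 * k) ℚ.* q) (ℚₚ.*-zeroʳ (fromℕ (2 * k)))
            (ℚₚ.*-monoˡ-≤-nonNeg (fromℕ (2 * k)) 0≤q)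
  d^k≤ : fromℕ d ^ k ℚ.≤ (fromℕ (2 * k) ℚ.* q) ^ k
  d^k≤ = begin
    fromℕ d ^ k                                    ≡⟨ fromℕ-^ d k ⟨
    fromℕ (d ℕ.^ k)                                ≤⟨ fromℕ-mono-≤ {d ℕ.^ k} {(2 * k) ℕ.^ k * n ℕ.^ (k + 1)} (turan k n 2≤k 1≤n e (proj₁ (ex-isMaximum n (1 + 2 * k)))) ⟩
    fromℕ ((2 * k) ℕ.^ k * n ℕ.^ (k + 1))          ≡⟨ fromℕ-* ((2 * k) ℕ.^ k) (n ℕ.^ (k + 1)) ⟩
    fromℕ ((2 * k) ℕ.^ k) ℚ.* fromℕ (n ℕ.^ (k + 1)) ≡⟨ cong (fromℕ ((2 * k) ℕ.^ k) ℚ.*_) (fromℕ-^ n (k + 1)) ⟩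
    fromℕ ((2 * k) ℕ.^ k) ℚ.* fromℕ n ^ (k + 1)    ≤⟨ ℚₚ.*-monoˡ-≤-nonNeg (fromℕ ((2 * k) ℕ.^ k)) n^k+1≤q^k ⟩
    fromℕ ((2 * k) ℕ.^ k) ℚ.* q ^ k                ≡⟨ cong (ℚ._* q ^ k) (fromℕ-^ (2 * k) k) ⟩
    fromℕ (2 * k) ^ k ℚ.* q ^ k                    ≡⟨ ^-distrib-* (fromℕ (2 * k)) q k ⟨
    (fromℕ (2 * k) ℚ.* q) ^ k                      ∎
  -- Positive powers increase strictly on nonnegative rationals, so comparing `k`-th powers replaces
  -- taking roots.
  d≮ : ¬ fromℕ (2 * k) ℚ.* q ℚ.< fromℕ d
  d≮ lt = ℚₚ.<-irrefl refl (ℚₚ.<-≤-trans (^-mono-<-nonNeg j 0≤2kq lt) d^k≤)
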